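{- $\displaystyle \liminf_{n\to\infty}\frac{p(n,3)}{s(n,3)} > 1.$
   Context: $p(n,3)$ denotes the number of paving matroids of rank $3$ on the ground set $[n]=\{1,\dots,n\}$ (rank-$3$ matroids all of whose circuits have at least $3$ elements), and $s(n,3)$ denotes the number of sparse paving matroids of rank $3$ on $[n]$ (rank-$3$ matroids in which every $3$-subset of $[n]$ is either a basis or a circuit-hyperplane). -}

module Defs where

open import Level using (0ℓ)
import Data.Bool.Properties as Bool
open import Data.Fin using (Fin)
import Data.Fin.Properties as Fin
open import Data.Fin.Subset
  using (Subset; inside; outside; ⊤; ∣_∣; _∈_; _∉_; _⊆_; _⊂_; _∪_; _-_; ⁅_⁆)
open import Data.Fin.Subset.Properties using (_∈?_; _⊆?_; _⊂?_; anySubset?)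
open import Data.Integer using (+_)
open import Data.List using (List; []; _∷_; _++_; map; filter; length)
open import Data.List.Extrema.Nat using (max)
import Data.List.Membership.DecPropositional as DecMembership
open import Data.Nat as ℕ using (ℕ; zero; suc)
open import Data.Product using (∃; ∃-syntax; _×_; _,_; proj₁)
open import Data.Rational as ℚ using (ℚ; 0ℚ)
open import Data.Sum using (_⊎_)
import Data.Vec as Vec
import Data.Vec.Properties as Vec
open import Relation.Binary.Definitions using (DecidableEquality)
open import Relation.Binary.PropositionalEquality using (_≡_)
open import Relation.Nullary using (Dec; ¬_)
open import Relation.Nullary.Decidable
  using (map′; ¬?; _×-dec_; _⊎-dec_; _→-dec_; decidable-stable)
open import Relation.Unary using (Pred; Decidable)

private
  variable
    n : ℕ

------------------------------------------------------------------------
-- Set systems on Fin n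

_≟ˢ_ : DecidableEquality (Subset n)
_≟ˢ_ = Vec.≡-dec Bool._≟_

module _ {n : ℕ} where
  open DecMembership (_≟ˢ_ {n}) public
    using () renaming (_∈_ to _∈ᶠ_; _∈?_ to _∈ᶠ?_)

Family : ℕ → Set
Family n = List (Subset n)

subsets : ∀ n → List (Subset n)
subsets zero    = Vec.[] ∷ []
subsets (suc n) = map (inside Vec.∷_) (subsets n) ++ map (outside Vec.∷_) (subsets n)

sublists : ∀ {A : Set} → List A → List (List A)
sublists []       = [] ∷ []
sublists (x ∷ xs) = map (x ∷_) (sublists xs) ++ sublists xs

-- `subsets n` lists every subset of Fin n exactly once, so its sublists
-- represent every set of subsets of Fin n exactly once.
families : ∀ n → List (Family n)
families n = sublists (subsets n)

allSubset? : {P : Pred (Subset n) 0ℓ} → Decidable P → Dec (∀ S → P S)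
allSubset? P? = map′
  (λ ¬∃¬ S → decidable-stable (P? S) (λ ¬PS → ¬∃¬ (S , ¬PS)))
  (λ ∀P (S , ¬PS) → ¬PS (∀P S))
  (¬? (anySubset? (λ S → ¬? (P? S))))

------------------------------------------------------------------------
-- Matroids on Fin n, given by their set of bases

module _ {n : ℕ} (𝓑 : Family n) where

  Exchange : Set
  Exchange = ∀ A B → A ∈ᶠ 𝓑 → B ∈ᶠ 𝓑 → ∀ x → x ∈ A → x ∉ B →
    ∃[ y ] (y ∈ B × y ∉ A × ((A - x) ∪ ⁅ y ⁆) ∈ᶠ 𝓑)

  IsMatroid : Set
  IsMatroid = (∃[ B ] B ∈ᶠ 𝓑) × Exchange

  Independent : Pred (Subset n) 0ℓ
  Independent I = ∃[ B ] (B ∈ᶠ 𝓑 × I ⊆ B)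

  Circuit : Pred (Subset n) 0ℓ
  Circuit C = ¬ Independent C × (∀ S → S ⊂ C → Independent S)

  exchange? : Dec Exchange
  exchange? = allSubset? λ A → allSubset? λ B →
    (A ∈ᶠ? 𝓑) →-dec (B ∈ᶠ? 𝓑) →-dec Fin.all? λ x →
    (x ∈? A) →-dec ¬? (x ∈? B) →-dec
    Fin.any? λ y → (y ∈? B) ×-dec ¬? (y ∈? A) ×-dec (((A - x) ∪ ⁅ y ⁆) ∈ᶠ? 𝓑)

  isMatroid? : Dec IsMatroid
  isMatroid? = anySubset? (_∈ᶠ? 𝓑) ×-dec exchange?

  independent? : Decidable Independent
  independent? I = anySubset? λ B → (B ∈ᶠ? 𝓑) ×-dec (I ⊆? B)

  circuit? : Decidable Circuit
  circuit? C = ¬? (independent? C) ×-dec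
    allSubset? λ S → (S ⊂? C) →-dec independent? S

  rank : Subset n → ℕ
  rank S = max 0 (map ∣_∣
    (filter (λ I → (I ⊆? S) ×-dec independent? I) (subsets n)))

  Flat : Pred (Subset n) 0ℓ
  Flat F = ∀ x → x ∉ F → rank F ℕ.< rank (F ∪ ⁅ x ⁆)

  Hyperplane : Pred (Subset n) 0ℓ
  Hyperplane H = Flat H × suc (rank H) ≡ rank ⊤

  hyperplane? : Decidable Hyperplane
  hyperplane? H =
    (Fin.all? λ x → ¬? (x ∈? H) →-dec (rank H ℕ.<? rank (H ∪ ⁅ x ⁆)))
    ×-dec (suc (rank H) ℕ.≟ rank ⊤)

  IsMatroidOfRank : ℕ → Set
  IsMatroidOfRank r = IsMatroid × rank ⊤ ≡ r

  Paving : ℕ → Set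
  Paving r = IsMatroidOfRank r × (∀ C → Circuit C → r ℕ.≤ ∣ C ∣)

  SparsePaving : ℕ → Set
  SparsePaving r = IsMatroidOfRank r ×
    (∀ S → ∣ S ∣ ≡ r → S ∈ᶠ 𝓑 ⊎ (Circuit S × Hyperplane S))

  isMatroidOfRank? : ∀ r → Dec (IsMatroidOfRank r)
  isMatroidOfRank? r = isMatroid? ×-dec (rank ⊤ ℕ.≟ r)

  paving? : ∀ r → Dec (Paving r)
  paving? r = isMatroidOfRank? r ×-dec
    allSubset? λ C → circuit? C →-dec (r ℕ.≤? ∣ C ∣)

  sparsePaving? : ∀ r → Dec (SparsePaving r)
  sparsePaving? r = isMatroidOfRank? r ×-dec
    allSubset? λ S → (∣ S ∣ ℕ.≟ r) →-dec
      ((S ∈ᶠ? 𝓑) ⊎-dec (circuit? S ×-dec hyperplane? S))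

p : ℕ → ℕ → ℕ
p n r = length (filter (λ 𝓑 → paving? 𝓑 r) (families n))

s : ℕ → ℕ → ℕ
s n r = length (filter (λ 𝓑 → sparsePaving? 𝓑 r) (families n))

------------------------------------------------------------------------
-- Limit inferior of a sequence of rationals

-- An extended real x is represented by its lower cut { q ∈ ℚ | q < x }.
LowerReal : Set₁
LowerReal = Pred ℚ 0ℓ

_<ᴸ_ : ℚ → LowerReal → Set
q <ᴸ x = x q

fromℚ : ℚ → LowerReal
fromℚ a q = q ℚ.< a

sup : {I : Set} → (I → LowerReal) → LowerReal
sup x q = ∃[ i ] q <ᴸ x i

-- The intersection of the cuts need not be open (it may contain the infimum
-- itself), hence the strictly larger q′.
inf : {I : Set} → (I → LowerReal) → LowerReal
inf x q = ∃[ q′ ] (q ℚ.< q′ × (∀ i → q′ <ᴸ x i))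

liminf : (ℕ → ℚ) → LowerReal
liminf a = sup λ N → inf λ ((n , _) : ∃[ n ] N ℕ.≤ n) → fromℚ (a n)

-- The value at a zero denominator is a convention.  For the ratio p n r / s n r
-- it only matters when n < r, since the uniform matroid of rank r ≤ n is sparse
-- paving; it therefore does not affect the limit inferior.
ratio : ℕ → ℕ → ℚ
ratio a zero      = 0ℚ
ratio a b@(suc _) = + a ℚ./ b

{-# OPTIONS --safe #-}
module Submission where

-- Let N be the set of nonbases of size 3.  In a sparse paving matroid of rank 3, N is a partial
-- triple system: two points lie in at most one triple of N.  Take a sparse paving matroid together
-- with four distinct points.  If some two of them, a and b, lie in a triple abc of N, let d ∉ {a,b,c}
-- be another of the four points and q = abcd; otherwise let q be the four points themselves.
-- Deleting from N all triples that share two points with q, and then making q a line, gives a paving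
-- matroid that is not sparse paving, and in which q is the only line with four points.  The deleted
-- triples are none at all, or abc, adx, bdy, cdz for some x, y, z.  So the data (matroid, four points)
-- are recovered from the new matroid, the points x, y, z, the last of the four points, and a bounded
-- amount of information.  As (matroid, four points) can be chosen in at least s(n,3) ⌊n/4⌋⁴ ways,
-- this gives s(n,3) ≤ D (p(n,3) − s(n,3)) with a constant D, for all n ≥ 5.

open import Defs
open import Data.Bool using (Bool; true; false)
open import Data.Empty using (⊥-elim)
open import Data.Fin as Fin using (Fin; zero; suc; finToFun; funToFin; combine; inject≤)
open import Data.Fin.Patterns
import Data.Fin.Properties as Fin
open import Data.Fin.Subset
  using (Subset; inside; outside; ⊥; ∣_∣; _∈_; _∉_; _⊆_; _⊂_; _∪_; _-_; _─_; ⁅_⁆)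
open import Data.Fin.Subset.Properties
open import Data.Integer using (+_)
import Data.Integer as ℤ
import Data.Integer.Properties as ℤ
open import Data.List
  using (List; []; _∷_; map; filter; length; cartesianProduct; allFin; lookup)
open import Data.List.Extrema.Nat using (max≤v⁺; v≤max⁺; argmax-sel)
import Data.List.Membership.Propositional as List
open import Data.List.Membership.Propositional.Properties
open import Data.List.Properties
  using (filter-accept; filter-reject; length-++; length-map; length-tabulate)
open import Data.List.Relation.Unary.All as All using ([]; _∷_)
open import Data.List.Relation.Unary.AllPairs using ([]; _∷_)
open import Data.List.Relation.Unary.Any as Any using (here; there)
open import Data.List.Relation.Unary.Any.Properties using (lookup-index)
open import Data.List.Relation.Unary.Unique.Propositional using (Unique)
import Data.List.Relation.Unary.Unique.Propositional.Properties as Unique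
open import Data.Nat as ℕ using (ℕ; zero; suc; _+_; _*_; _^_; _≤_; _<_; z≤n; s≤s)
open import Data.Nat.DivMod using (_/_; _%_; m≡m%n+[m/n]*n; m%n<n; m/n*n≤m; m≥n⇒m/n>0)
import Data.Nat.Properties as ℕ
open import Data.Nat.Solver using (module +-*-Solver)
open import Data.Product using (∃-syntax; _×_; _,_; proj₁; proj₂)
open import Data.Rational as ℚ using (1ℚ)
import Data.Rational.Properties as ℚ
open import Data.Rational.Unnormalised using (mkℚᵘ; *<*)
import Data.Rational.Unnormalised.Properties as ℚᵘ
open import Data.Sum as Sum using (_⊎_; inj₁; inj₂; [_,_]′)
import Data.Vec as Vec
open import Data.Vec.Base using (here; there)
open import Function using (_∘_; id)
open import Function.Definitions using (Injective)
open import Level using (0ℓ)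
open import Relation.Binary.Definitions using (tri<; tri≈; tri>)
open import Relation.Binary.PropositionalEquality
open import Relation.Nullary using (¬_; Dec; yes; no; contradiction)
open import Relation.Nullary.Decidable
  using (_×-dec_; _⊎-dec_; _→-dec_; ¬?; from-yes; decidable-stable)
open import Relation.Unary using (Pred; Decidable)

-- Counting by injective relations; sublists of a duplicate-free list.

module _ {A : Set} where

  lookup-injective : {xs : List A} → Unique xs → ∀ i j → lookup xs i ≡ lookup xs j → i ≡ j
  lookup-injective (_ ∷ _)   zero    zero    _  = refl
  lookup-injective (x≢ ∷ _)  zero    (suc j) eq = contradiction eq (All.lookup x≢ (∈-lookup j))
  lookup-injective (x≢ ∷ _)  (suc i) zero    eq =
    contradiction (sym eq) (All.lookup x≢ (∈-lookup i))
  lookup-injective (_ ∷ xs!) (suc i) (suc j) eq = cong suc (lookup-injective xs! i j eq)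

  -- The index of a chosen partner defines an injection between the index sets. Working with a
  -- relation means that a partner only has to exist, while injectivity can be read off from a
  -- decoding.
  length-≤ : {B : Set} {xs : List A} {ys : List B} (R : A → B → Set) → Unique xs →
    (∀ {x} → x List.∈ xs → ∃[ y ] y List.∈ ys × R x y) →
    (∀ {x x′ y} → R x y → R x′ y → x ≡ x′) → length xs ≤ length ys
  length-≤ {xs = xs} {ys} R xs! total injective = Fin.injective⇒≤ {f = f} f-injective
    where
    f : Fin (length xs) → Fin (length ys)
    f i = Any.index (proj₁ (proj₂ (total (∈-lookup i))))

    R-lookup : ∀ i → R (lookup xs i) (lookup ys (f i))
    R-lookup i with total (∈-lookup {xs = xs} i)
    ... | y , y∈ , r = subst (R _) (lookup-index y∈) r

    f-injective : ∀ {i j} → f i ≡ f j → i ≡ j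
    f-injective {i} {j} eq = lookup-injective xs! i j
      (injective (R-lookup i) (subst (λ k → R (lookup xs j) (lookup ys k)) (sym eq) (R-lookup j)))

  length-filter-split : {P Q : Pred A 0ℓ} (P? : Decidable P) (Q? : Decidable Q) →
    (∀ {x} → Q x → P x) → ∀ xs →
    length (filter P? xs) ≡
      length (filter Q? xs) + length (filter (λ x → P? x ×-dec ¬? (Q? x)) xs)
  length-filter-split P? Q? Q⇒P [] = refl
  length-filter-split P? Q? Q⇒P (x ∷ xs) with ih ← length-filter-split P? Q? Q⇒P xs | P? x | Q? x
  ... | yes _  | yes _ = cong suc ih
  ... | yes _  | no  _ = trans (cong suc ih) (sym (ℕ.+-suc _ _))
  ... | no _   | no  _ = ih
  ... | no ¬Px | yes q = contradiction (Q⇒P q) ¬Px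

  length-cartesianProduct : {B : Set} (xs : List A) (ys : List B) →
    length (cartesianProduct xs ys) ≡ length xs * length ys
  length-cartesianProduct []       ys = refl
  length-cartesianProduct (x ∷ xs) ys = trans (length-++ (map (x ,_) ys))
    (cong₂ _+_ (length-map (x ,_) ys) (length-cartesianProduct xs ys))

  filter∈sublists : {P : Pred A 0ℓ} (P? : Decidable P) → ∀ xs → filter P? xs List.∈ sublists xs
  filter∈sublists P? [] = here refl
  filter∈sublists P? (x ∷ xs) with P? x
  ... | yes _ = ∈-++⁺ˡ (∈-map⁺ (x ∷_) (filter∈sublists P? xs))
  ... | no  _ = ∈-++⁺ʳ (map (x ∷_) (sublists xs)) (filter∈sublists P? xs)

  ∈-sublists⁻ : ∀ {x : A} {xs ys} → ys List.∈ sublists xs → x List.∈ ys → x List.∈ xs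
  ∈-sublists⁻ {xs = []} (here refl) ()
  ∈-sublists⁻ {xs = z ∷ xs} ys∈ x∈ with ∈-++⁻ (map (z ∷_) (sublists xs)) ys∈
  ... | inj₂ ys∈′ = there (∈-sublists⁻ ys∈′ x∈)
  ... | inj₁ zys∈ with ∈-map⁻ (z ∷_) zys∈ | x∈
  ...   | _ , ys∈′ , refl | here refl = here refl
  ...   | _ , ys∈′ , refl | there x∈′ = there (∈-sublists⁻ ys∈′ x∈′)

  sublists-unique : {xs : List A} → Unique xs → Unique (sublists xs)
  sublists-unique [] = [] ∷ []
  sublists-unique {x ∷ xs} (x≢ ∷ xs!) = Unique.++⁺
    (Unique.map⁺ (λ { refl → refl }) (sublists-unique xs!)) (sublists-unique xs!) disjoint
    where
    disjoint : ∀ {ys} → ys List.∈ map (x ∷_) (sublists xs) × ys List.∈ sublists xs → _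
    disjoint (xys∈ , ys∈) with ∈-map⁻ (x ∷_) xys∈
    ... | _ , _ , refl = All.lookup x≢ (∈-sublists⁻ ys∈ (here refl)) refl

  -- In a duplicate-free list a sublist is determined by its members, because the order is
  -- inherited.
  sublist≡filter : {P : Pred A 0ℓ} (P? : Decidable P) → ∀ {xs ys} → Unique xs → ys List.∈ sublists xs →
    (∀ {x} → x List.∈ xs → x List.∈ ys → P x) → (∀ {x} → x List.∈ xs → P x → x List.∈ ys) → ys ≡ filter P? xs
  sublist≡filter P? [] (here refl) _ _ = refl
  sublist≡filter P? {x ∷ xs} (x≢ ∷ xs!) ys∈ sound complete
    with ∈-++⁻ (map (x ∷_) (sublists xs)) ys∈
  ... | inj₂ ys∈′ = trans
    (sublist≡filter P? xs! ys∈′ (sound ∘ there) (complete ∘ there))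
    (sym (filter-reject P? λ Px → All.lookup x≢ (∈-sublists⁻ ys∈′ (complete (here refl) Px)) refl))
  ... | inj₁ xys∈ with ∈-map⁻ (x ∷_) xys∈
  ...   | zs , zs∈ , refl = trans
    (cong (x ∷_) (sublist≡filter P? xs! zs∈ (λ z∈ → sound (there z∈) ∘ there) complete′))
    (sym (filter-accept P? (sound (here refl) (here refl))))
    where
    complete′ : ∀ {z} → z List.∈ xs → _ → z List.∈ zs
    complete′ z∈ Pz with complete (there z∈) Pz
    ... | here refl = contradiction refl (All.lookup x≢ z∈)
    ... | there z∈′ = z∈′

-- Set systems as sublists of the list of all subsets.

subsets-unique : ∀ n → Unique (subsets n)
subsets-unique zero    = [] ∷ []
subsets-unique (suc n) = Unique.++⁺
  (Unique.map⁺ (λ { refl → refl }) (subsets-unique n))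
  (Unique.map⁺ (λ { refl → refl }) (subsets-unique n)) disjoint
  where
  disjoint : ∀ {S} → S List.∈ map (inside Vec.∷_) (subsets n) × S List.∈ map (outside Vec.∷_) (subsets n) → _
  disjoint (S∈ , S∈′) with ∈-map⁻ (inside Vec.∷_) S∈ | ∈-map⁻ (outside Vec.∷_) S∈′
  ... | _ , _ , refl | _ , _ , ()

∈-subsets : ∀ {n} (S : Subset n) → S List.∈ subsets n
∈-subsets Vec.[] = here refl
∈-subsets (inside Vec.∷ S) = ∈-++⁺ˡ (∈-map⁺ (inside Vec.∷_) (∈-subsets S))
∈-subsets {suc n} (outside Vec.∷ S) =
  ∈-++⁺ʳ (map (inside Vec.∷_) (subsets n)) (∈-map⁺ (outside Vec.∷_) (∈-subsets S))

module _ {n : ℕ} {P : Pred (Subset n) 0ℓ} (P? : Decidable P) where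

  opaque

    family : Family n
    family = filter P? (subsets n)

    family∈families : family List.∈ families n
    family∈families = filter∈sublists P? (subsets n)

    ∈-family⁺ : ∀ {S} → P S → S ∈ᶠ family
    ∈-family⁺ {S} = ∈-filter⁺ P? (∈-subsets S)

    ∈-family⁻ : ∀ {S} → S ∈ᶠ family → P S
    ∈-family⁻ = proj₂ ∘ ∈-filter⁻ P? {xs = subsets n}

    -- Extensionality: it turns agreement of members into equality of lists, as needed to decode a
    -- family exactly.
    ≡family : ∀ {𝓑} → 𝓑 List.∈ families n → (∀ {S} → S ∈ᶠ 𝓑 → P S) → (∀ {S} → P S → S ∈ᶠ 𝓑) → 𝓑 ≡ family
    ≡family 𝓑∈ sound complete = sublist≡filter P? (subsets-unique n) 𝓑∈ (λ _ → sound) (λ _ → complete)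

families-unique : ∀ n → Unique (families n)
families-unique n = sublists-unique (subsets-unique n)

-- Triples of points

private
  variable
    n : ℕ
    S T : Subset n
    a b c x y : Fin n

∈-∪⁻ : x ∈ S ∪ T → x ∈ S ⊎ x ∈ T
∈-∪⁻ = x∈p∪q⁻ _ _

∈⁅⁆⁻ : x ∈ ⁅ y ⁆ → x ≡ y
∈⁅⁆⁻ = x∈⁅y⁆⇒x≡y _

x∈p─q⇒x∉q : ∀ (p q : Subset n) → x ∈ p ─ q → x ∉ q
x∈p─q⇒x∉q (_ Vec.∷ p) (outside Vec.∷ q) (there x∈) (there x∈q) = x∈p─q⇒x∉q p q x∈ x∈q
x∈p─q⇒x∉q (_ Vec.∷ p) (inside Vec.∷ q)  (there x∈) (there x∈q) = x∈p─q⇒x∉q p q x∈ x∈q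

x∉S-x : ∀ (S : Subset n) x → x ∉ S - x
x∉S-x S x x∈ = x∈p─q⇒x∉q S ⁅ x ⁆ x∈ (x∈⁅x⁆ x)

∈--⁻ : x ∈ S - y → x ∈ S × x ≢ y
∈--⁻ {S = S} {y = y} x∈ = p─q⊆p S ⁅ y ⁆ x∈ , λ { refl → x∉S-x S y x∈ }

⁅x⁆∪[S-x]≡S : x ∈ S → ⁅ x ⁆ ∪ (S - x) ≡ S
⁅x⁆∪[S-x]≡S {x = x} {S = S} x∈S = ⊆-antisym sound complete
  where
  sound : ⁅ x ⁆ ∪ (S - x) ⊆ S
  sound y∈ with ∈-∪⁻ y∈
  ... | inj₁ y∈x with refl ← ∈⁅⁆⁻ y∈x = x∈S
  ... | inj₂ y∈- = proj₁ (∈--⁻ y∈-)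
  complete : S ⊆ ⁅ x ⁆ ∪ (S - x)
  complete {y} y∈S with y Fin.≟ x
  ... | yes refl = x∈p∪q⁺ (inj₁ (x∈⁅x⁆ x))
  ... | no y≢x = x∈p∪q⁺ (inj₂ (x∈p∧x≢y⇒x∈p-y y∈S y≢x))

∣⁅x⁆∪S∣≡1+∣S∣ : x ∉ S → ∣ ⁅ x ⁆ ∪ S ∣ ≡ suc ∣ S ∣
∣⁅x⁆∪S∣≡1+∣S∣ {x = zero}  {S = inside Vec.∷ S}  x∉S = contradiction here x∉S
∣⁅x⁆∪S∣≡1+∣S∣ {x = zero}  {S = outside Vec.∷ S} x∉S = cong (suc ∘ ∣_∣) (∪-identityˡ S)
∣⁅x⁆∪S∣≡1+∣S∣ {x = suc x} {S = inside Vec.∷ S}  x∉S = cong suc (∣⁅x⁆∪S∣≡1+∣S∣ (x∉S ∘ there))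
∣⁅x⁆∪S∣≡1+∣S∣ {x = suc x} {S = outside Vec.∷ S} x∉S = ∣⁅x⁆∪S∣≡1+∣S∣ (x∉S ∘ there)

∣S∣≡1+∣S-x∣ : x ∈ S → ∣ S ∣ ≡ suc ∣ S - x ∣
∣S∣≡1+∣S-x∣ {x = x} {S = S} x∈S =
  trans (cong ∣_∣ (sym (⁅x⁆∪[S-x]≡S x∈S))) (∣⁅x⁆∪S∣≡1+∣S∣ (x∉S-x S x))

∣⁅x⁆∪S∣≤1+∣S∣ : ∀ x (S : Subset n) → ∣ ⁅ x ⁆ ∪ S ∣ ≤ suc ∣ S ∣
∣⁅x⁆∪S∣≤1+∣S∣ x S with x ∈? S
... | no x∉S = ℕ.≤-reflexive (∣⁅x⁆∪S∣≡1+∣S∣ x∉S)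
... | yes x∈S = ℕ.m≤n⇒m≤1+n (p⊆q⇒∣p∣≤∣q∣
  ([ (λ z∈ → subst (_∈ S) (sym (∈⁅⁆⁻ z∈)) x∈S) , (λ z∈ → z∈) ]′ ∘ ∈-∪⁻))

∣S∣≡0⇒S≡⊥ : ∣ S ∣ ≡ 0 → S ≡ ⊥
∣S∣≡0⇒S≡⊥ {S = S} eq with nonempty? S
... | no empty = Empty-unique empty
... | yes (x , x∈S) = contradiction (trans (sym eq) (∣S∣≡1+∣S-x∣ x∈S)) λ ()

∣S∣≡1+k⇒nonempty : ∀ {n} {S : Subset n} {k} → ∣ S ∣ ≡ suc k → ∃[ x ] x ∈ S
∣S∣≡1+k⇒nonempty {n} {S} eq with nonempty? S
... | yes ne = ne
... | no empty = contradiction (trans (sym eq) (trans (cong ∣_∣ (Empty-unique empty)) (∣⊥∣≡0 n))) λ ()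

∣S-x∣≡k : ∀ {k} → x ∈ S → ∣ S ∣ ≡ suc k → ∣ S - x ∣ ≡ k
∣S-x∣≡k x∈S eq = ℕ.suc-injective (trans (sym (∣S∣≡1+∣S-x∣ x∈S)) eq)

S⊆T∧∣T∣≤∣S∣⇒S≡T : S ⊆ T → ∣ T ∣ ≤ ∣ S ∣ → S ≡ T
S⊆T∧∣T∣≤∣S∣⇒S≡T {S = S} {T = T} S⊆T ∣T∣≤∣S∣ = ⊆-antisym S⊆T T⊆S
  where
  T⊆S : T ⊆ S
  T⊆S {x} x∈T with x ∈? S
  ... | yes x∈S = x∈S
  ... | no x∉S = contradiction ∣T∣≤∣S∣ (ℕ.<⇒≱ (p⊂q⇒∣p∣<∣q∣ (S⊆T , x , x∈T , x∉S)))

opaque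

  triple : Fin n → Fin n → Fin n → Subset n
  triple a b c = ⁅ a ⁆ ∪ (⁅ b ⁆ ∪ ⁅ c ⁆)

  ∈-triple⁻ : x ∈ triple a b c → x ≡ a ⊎ x ≡ b ⊎ x ≡ c
  ∈-triple⁻ x∈ with ∈-∪⁻ x∈
  ... | inj₁ x∈a = inj₁ (∈⁅⁆⁻ x∈a)
  ... | inj₂ x∈′ with ∈-∪⁻ x∈′
  ...   | inj₁ x∈b = inj₂ (inj₁ (∈⁅⁆⁻ x∈b))
  ...   | inj₂ x∈c = inj₂ (inj₂ (∈⁅⁆⁻ x∈c))

  ∈-triple₁ : a ∈ triple a b c
  ∈-triple₁ = x∈p∪q⁺ (inj₁ (x∈⁅x⁆ _))

  ∈-triple₂ : b ∈ triple a b c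
  ∈-triple₂ = x∈p∪q⁺ (inj₂ (x∈p∪q⁺ (inj₁ (x∈⁅x⁆ _))))

  ∈-triple₃ : c ∈ triple a b c
  ∈-triple₃ = x∈p∪q⁺ (inj₂ (x∈p∪q⁺ (inj₂ (x∈⁅x⁆ _))))

triple-⊆ : a ∈ S → b ∈ S → c ∈ S → triple a b c ⊆ S
triple-⊆ a∈ b∈ c∈ x∈ with ∈-triple⁻ x∈
... | inj₁ refl = a∈
... | inj₂ (inj₁ refl) = b∈
... | inj₂ (inj₂ refl) = c∈

triple-swapˡ : ∀ a b (c : Fin n) → triple a b c ≡ triple b a c
triple-swapˡ a b c = ⊆-antisym (triple-⊆ ∈-triple₂ ∈-triple₁ ∈-triple₃)
                               (triple-⊆ ∈-triple₂ ∈-triple₁ ∈-triple₃)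

triple-swapʳ : ∀ a b (c : Fin n) → triple a b c ≡ triple a c b
triple-swapʳ a b c = ⊆-antisym (triple-⊆ ∈-triple₁ ∈-triple₃ ∈-triple₂)
                               (triple-⊆ ∈-triple₁ ∈-triple₃ ∈-triple₂)

opaque
  unfolding triple

  ∣S∣≡3⇒triple : ∣ S ∣ ≡ 3 → x ∈ S →
    ∃[ y ] ∃[ z ] (S ≡ triple x y z × x ≢ y × x ≢ z × y ≢ z)
  ∣S∣≡3⇒triple {S = S} {x = x} eq x∈S
    with eq₂ ← ∣S-x∣≡k x∈S eq
    with y , y∈ ← ∣S∣≡1+k⇒nonempty eq₂
    with eq₁ ← ∣S-x∣≡k y∈ eq₂
    with z , z∈ ← ∣S∣≡1+k⇒nonempty eq₁
    with eq₀ ← ∣S-x∣≡k z∈ eq₁ =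
    y , z , S≡ , ≢-sym (proj₂ (∈--⁻ y∈)) , ≢-sym (proj₂ (∈--⁻ (proj₁ (∈--⁻ z∈)))) ,
    ≢-sym (proj₂ (∈--⁻ z∈))
    where
    open ≡-Reasoning
    S≡ : S ≡ triple x y z
    S≡ = begin
      S                                            ≡⟨ ⁅x⁆∪[S-x]≡S x∈S ⟨
      ⁅ x ⁆ ∪ (S - x)                              ≡⟨ cong (⁅ x ⁆ ∪_) (⁅x⁆∪[S-x]≡S y∈) ⟨
      ⁅ x ⁆ ∪ (⁅ y ⁆ ∪ (S - x - y))                ≡⟨ cong (λ T → ⁅ x ⁆ ∪ (⁅ y ⁆ ∪ T)) (⁅x⁆∪[S-x]≡S z∈) ⟨
      ⁅ x ⁆ ∪ (⁅ y ⁆ ∪ (⁅ z ⁆ ∪ (S - x - y - z)))  ≡⟨ cong (λ T → ⁅ x ⁆ ∪ (⁅ y ⁆ ∪ (⁅ z ⁆ ∪ T))) (∣S∣≡0⇒S≡⊥ eq₀) ⟩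
      ⁅ x ⁆ ∪ (⁅ y ⁆ ∪ (⁅ z ⁆ ∪ ⊥))                ≡⟨ cong (λ T → ⁅ x ⁆ ∪ (⁅ y ⁆ ∪ T)) (∪-identityʳ ⁅ z ⁆) ⟩
      triple x y z                                 ∎

∣S∣≡3⇒triple₂ : ∣ S ∣ ≡ 3 → x ∈ S → y ∈ S → x ≢ y →
  ∃[ z ] (S ≡ triple x y z × x ≢ z × y ≢ z)
∣S∣≡3⇒triple₂ {x = x} {y = y} eq x∈S y∈S x≢y with ∣S∣≡3⇒triple eq x∈S
... | u , v , refl , x≢u , x≢v , u≢v with ∈-triple⁻ y∈S
...   | inj₁ refl = contradiction refl x≢y
...   | inj₂ (inj₁ refl) = v , refl , x≢v , u≢v
...   | inj₂ (inj₂ refl) = u , triple-swapʳ x u v , x≢u , ≢-sym u≢v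

∣pair∣≡2 : a ≢ b → ∣ ⁅ a ⁆ ∪ ⁅ b ⁆ ∣ ≡ 2
∣pair∣≡2 {b = b} a≢b = trans (∣⁅x⁆∪S∣≡1+∣S∣ (a≢b ∘ ∈⁅⁆⁻)) (cong suc (∣⁅x⁆∣≡1 b))

opaque
  unfolding triple

  ∣triple∣≡3 : a ≢ b → a ≢ c → b ≢ c → ∣ triple a b c ∣ ≡ 3
  ∣triple∣≡3 a≢b a≢c b≢c = trans
    (∣⁅x⁆∪S∣≡1+∣S∣ ([ a≢b ∘ ∈⁅⁆⁻ , a≢c ∘ ∈⁅⁆⁻ ]′ ∘ ∈-∪⁻)) (cong suc (∣pair∣≡2 b≢c))

∣triple∣≡3⇒≢ : ∣ triple a b c ∣ ≡ 3 → a ≢ b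
∣triple∣≡3⇒≢ {a = a} {c = c} eq refl = ℕ.<⇒≱ (s≤s (s≤s (s≤s z≤n))) (begin
  3                    ≡⟨ eq ⟨
  ∣ triple a a c ∣     ≤⟨ p⊆q⇒∣p∣≤∣q∣ {p = triple a a c} {q = ⁅ a ⁆ ∪ ⁅ c ⁆}
                          (triple-⊆ (x∈p∪q⁺ (inj₁ (x∈⁅x⁆ a))) (x∈p∪q⁺ (inj₁ (x∈⁅x⁆ a)))
                                    (x∈p∪q⁺ (inj₂ (x∈⁅x⁆ c)))) ⟩
  ∣ ⁅ a ⁆ ∪ ⁅ c ⁆ ∣    ≤⟨ ∣⁅x⁆∪S∣≤1+∣S∣ a ⁅ c ⁆ ⟩
  suc ∣ ⁅ c ⁆ ∣        ≡⟨ cong suc (∣⁅x⁆∣≡1 c) ⟩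
  2                    ∎)
  where open ℕ.≤-Reasoning

∣triple∣≡3⇒distinct : ∣ triple a b c ∣ ≡ 3 → a ≢ b × a ≢ c × b ≢ c
∣triple∣≡3⇒distinct {a = a} {b} {c} eq =
  ∣triple∣≡3⇒≢ eq ,
  ∣triple∣≡3⇒≢ (trans (cong ∣_∣ (triple-swapʳ a c b)) eq) ,
  ∣triple∣≡3⇒≢ (trans (cong ∣_∣ (trans (triple-swapʳ b c a) (triple-swapˡ b a c))) eq)

triple-exchange : a ≢ b → a ≢ c → (triple a b c - a) ∪ ⁅ y ⁆ ≡ triple b c y
triple-exchange {a = a} {b} {c} {y} a≢b a≢c = ⊆-antisym sound (triple-⊆
  (x∈p∪q⁺ (inj₁ (x∈p∧x≢y⇒x∈p-y ∈-triple₂ (≢-sym a≢b))))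
  (x∈p∪q⁺ (inj₁ (x∈p∧x≢y⇒x∈p-y ∈-triple₃ (≢-sym a≢c))))
  (x∈p∪q⁺ (inj₂ (x∈⁅x⁆ y))))
  where
  sound : (triple a b c - a) ∪ ⁅ y ⁆ ⊆ triple b c y
  sound x∈ with ∈-∪⁻ x∈
  ... | inj₂ x∈y with refl ← ∈⁅⁆⁻ x∈y = ∈-triple₃
  ... | inj₁ x∈- with ∈--⁻ x∈-
  ...   | x∈abc , x≢a with ∈-triple⁻ x∈abc
  ...     | inj₁ x≡a = contradiction x≡a x≢a
  ...     | inj₂ (inj₁ refl) = ∈-triple₁
  ...     | inj₂ (inj₂ refl) = ∈-triple₂

-- Matroids of rank 3 and their collinear triples

module _ {n : ℕ} (𝓑 : Family n) where

  private
    IndependentIn : Subset n → Subset n → Set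
    IndependentIn S I = I ⊆ S × Independent 𝓑 I

    independentIn? : ∀ S I → Dec (IndependentIn S I)
    independentIn? S I = (I ⊆? S) ×-dec independent? 𝓑 I

  rank-≤ : ∀ {S k} → (∀ {I} → I ⊆ S → Independent 𝓑 I → ∣ I ∣ ≤ k) → rank 𝓑 S ≤ k
  rank-≤ {S} bound = max≤v⁺ z≤n (All.tabulate λ k∈ →
    let I , I∈ , eq = ∈-map⁻ ∣_∣ k∈
        I⊆S , ind = proj₂ (∈-filter⁻ (independentIn? S) {xs = subsets n} I∈)
    in ℕ.≤-trans (ℕ.≤-reflexive eq) (bound I⊆S ind))

  ≤-rank : ∀ {S I} → I ⊆ S → Independent 𝓑 I → ∣ I ∣ ≤ rank 𝓑 S
  ≤-rank {S} {I} I⊆S ind = v≤max⁺ 0 _ (inj₂ (Any.map ℕ.≤-reflexive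
    (∈-map⁺ ∣_∣ (∈-filter⁺ (independentIn? S) (∈-subsets I) ((λ {x} → I⊆S {x}) , ind)))))

  rank-attained : ∀ {S k} → suc k ≤ rank 𝓑 S → ∃[ I ] (I ⊆ S × Independent 𝓑 I × suc k ≤ ∣ I ∣)
  rank-attained {S} {k} k<rank
    with argmax-sel id 0 (map ∣_∣ (filter (independentIn? S) (subsets n)))
  ... | inj₁ eq = contradiction (subst (suc k ≤_) eq k<rank) λ ()
  ... | inj₂ r∈ with ∈-map⁻ ∣_∣ r∈
  ...   | I , I∈ , eq with ∈-filter⁻ (independentIn? S) {xs = subsets n} I∈
  ...     | _ , I⊆S , ind = I , (λ {x} → I⊆S {x}) , ind , subst (suc k ≤_) eq k<rank

  Uniform₃ : Set
  Uniform₃ = ∀ {B} → B ∈ᶠ 𝓑 → ∣ B ∣ ≡ 3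

  -- Holds in particular when two of the points coincide, as long as all bases have three elements.
  Collinear : Fin n → Fin n → Fin n → Set
  Collinear a b c = ¬ (triple a b c ∈ᶠ 𝓑)

  collinear-swapˡ : ∀ {a b c} → Collinear a b c → Collinear b a c
  collinear-swapˡ {a} {b} {c} = subst (λ S → ¬ (S ∈ᶠ 𝓑)) (triple-swapˡ a b c)

  collinear-swapʳ : ∀ {a b c} → Collinear a b c → Collinear a c b
  collinear-swapʳ {a} {b} {c} = subst (λ S → ¬ (S ∈ᶠ 𝓑)) (triple-swapʳ a b c)

  -- The linear space axiom in terms of nonbases. Degenerate triples are included, so that lines can
  -- be re-based without case distinctions.
  TwoPointsSpanLine : Set
  TwoPointsSpanLine = ∀ {a b u v} → a ≢ b → Collinear a b u → Collinear a b v → Collinear a u v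

  basis-triple : Uniform₃ → ∀ {B} → B ∈ᶠ 𝓑 → ∃[ a ] ∃[ b ] ∃[ c ] B ≡ triple a b c
  basis-triple uniform B∈ with a , a∈ ← ∣S∣≡1+k⇒nonempty (uniform B∈)
    with b , c , B≡ , _ ← ∣S∣≡3⇒triple (uniform B∈) a∈ = a , b , c , B≡

  module _ (uniform : Uniform₃) (line : TwoPointsSpanLine) where

    -- The line is re-based from the pair `a`, `b` to the pair `u`, `a`; this pair is proper unless
    -- `a` equals `u`, where the axiom applies directly.
    line-collinear : ∀ {a b u v w} → a ≢ b →
      Collinear a b u → Collinear a b v → Collinear a b w → Collinear u v w
    line-collinear {a} {b} {u} a≢b abu abv abw with a Fin.≟ u
    ... | yes refl = line a≢b abv abw
    ... | no a≢u = line (≢-sym a≢u) (collinear-swapˡ (line a≢b abu abv))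
                                    (collinear-swapˡ (line a≢b abu abw))

    -- Otherwise all three points of `B` would lie on the line through `a` and `b`, making `B` a
    -- nonbasis.
    pair-extends : ∀ {a b B} → a ≢ b → B ∈ᶠ 𝓑 → ∃[ y ] (y ∈ B × triple a b y ∈ᶠ 𝓑)
    pair-extends {a} {b} a≢b B∈ with basis-triple uniform B∈
    ... | u , v , w , refl
      with triple a b u ∈ᶠ? 𝓑 | triple a b v ∈ᶠ? 𝓑 | triple a b w ∈ᶠ? 𝓑
    ... | yes abu | _ | _ = u , ∈-triple₁ , abu
    ... | no _ | yes abv | _ = v , ∈-triple₂ , abv
    ... | no _ | no _ | yes abw = w , ∈-triple₃ , abw
    ... | no abu | no abv | no abw = contradiction B∈ (line-collinear a≢b abu abv abw)

    -- The two points of `A` other than `x` extend by a point of `B`. That point is not in `A`: it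
    -- differs from `x`, which is not in `B`, and from the other two because bases have three
    -- elements.
    exchange : Exchange 𝓑
    exchange A B A∈ B∈ x x∈A x∉B with ∣S∣≡3⇒triple (uniform A∈) x∈A
    ... | b , c , refl , x≢b , x≢c , b≢c with pair-extends b≢c B∈
    ... | y , y∈B , bcy = y , y∈B , y∉A , subst (_∈ᶠ 𝓑) (sym (triple-exchange x≢b x≢c)) bcy
      where
      y∉A : y ∉ triple x b c
      y∉A y∈A with ∈-triple⁻ y∈A | ∣triple∣≡3⇒distinct (uniform bcy)
      ... | inj₁ refl | _ = x∉B y∈B
      ... | inj₂ (inj₁ refl) | _ , b≢y , _ = b≢y refl
      ... | inj₂ (inj₂ refl) | _ , _ , c≢y = c≢y refl

    module _ {B} (B∈ : B ∈ᶠ 𝓑) where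

      isMatroidOfRank₃ : IsMatroidOfRank 𝓑 3
      isMatroidOfRank₃ = ((B , B∈) , exchange) , ℕ.≤-antisym
        (rank-≤ λ { _ (B′ , B′∈ , I⊆B′) →
          ℕ.≤-trans (p⊆q⇒∣p∣≤∣q∣ I⊆B′) (ℕ.≤-reflexive (uniform B′∈)) })
        (subst (_≤ _) (uniform B∈) (≤-rank {I = B} ⊆⊤ (B , B∈ , id)))

      singleton-independent : ∀ a → Independent 𝓑 ⁅ a ⁆
      singleton-independent a with a ∈? B
      ... | yes a∈B = B , B∈ , λ x∈ → subst (_∈ B) (sym (∈⁅⁆⁻ x∈)) a∈B
      ... | no a∉B with b , b∈ ← ∣S∣≡1+k⇒nonempty (uniform B∈)
        with y , _ , aby ← pair-extends {a} {b} (λ { refl → a∉B b∈ }) B∈ =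
        triple a b y , aby , λ x∈ → subst (_∈ triple a b y) (sym (∈⁅⁆⁻ x∈)) ∈-triple₁

      pair-independent : ∀ {a b} → a ≢ b → Independent 𝓑 (⁅ a ⁆ ∪ ⁅ b ⁆)
      pair-independent {a} {b} a≢b with y , _ , aby ← pair-extends a≢b B∈ =
        triple a b y , aby , λ x∈ →
          [ (λ x∈a → subst (_∈ triple a b y) (sym (∈⁅⁆⁻ x∈a)) ∈-triple₁)
          , (λ x∈b → subst (_∈ triple a b y) (sym (∈⁅⁆⁻ x∈b)) ∈-triple₂) ]′ (∈-∪⁻ x∈)

      independent-≤2 : ∀ {S} → ∣ S ∣ ≤ 2 → Independent 𝓑 S
      independent-≤2 {S} ∣S∣≤2 with ∣ S ∣ in eq
      ... | 0 = B , B∈ , λ x∈ → contradiction (subst (_ ∈_) (∣S∣≡0⇒S≡⊥ eq) x∈) ∉⊥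
      ... | 1 with a , a∈ ← ∣S∣≡1+k⇒nonempty eq = subst (Independent 𝓑)
        (trans (sym (∪-identityʳ ⁅ a ⁆))
          (trans (cong (⁅ a ⁆ ∪_) (sym (∣S∣≡0⇒S≡⊥ (∣S-x∣≡k a∈ eq)))) (⁅x⁆∪[S-x]≡S a∈)))
        (singleton-independent a)
      ... | 2 with a , a∈ ← ∣S∣≡1+k⇒nonempty eq
        with eq₁ ← ∣S-x∣≡k a∈ eq
        with b , b∈ ← ∣S∣≡1+k⇒nonempty eq₁ = subst (Independent 𝓑) S≡
          (pair-independent (≢-sym (proj₂ (∈--⁻ b∈))))
          where
          open ≡-Reasoning
          S≡ : ⁅ a ⁆ ∪ ⁅ b ⁆ ≡ S
          S≡ = begin
            ⁅ a ⁆ ∪ ⁅ b ⁆                  ≡⟨ cong (⁅ a ⁆ ∪_) (∪-identityʳ ⁅ b ⁆) ⟨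
            ⁅ a ⁆ ∪ (⁅ b ⁆ ∪ ⊥)            ≡⟨ cong (λ T → ⁅ a ⁆ ∪ (⁅ b ⁆ ∪ T)) (∣S∣≡0⇒S≡⊥ (∣S-x∣≡k b∈ eq₁)) ⟨
            ⁅ a ⁆ ∪ (⁅ b ⁆ ∪ (S - a - b))  ≡⟨ cong (⁅ a ⁆ ∪_) (⁅x⁆∪[S-x]≡S b∈) ⟩
            ⁅ a ⁆ ∪ (S - a)                ≡⟨ ⁅x⁆∪[S-x]≡S a∈ ⟩
            S                              ∎
      independent-≤2 (s≤s (s≤s ())) | suc (suc (suc _))

      paving₃ : Paving 𝓑 3
      paving₃ = isMatroidOfRank₃ , λ C (¬ind , _) →
        ℕ.≰⇒> (¬ind ∘ independent-≤2)

  -- Bases are equicardinal: an exchange step preserves the size of `A` and shrinks `A ─ B`, whose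
  -- size is bounded by the induction variable `k`.
  exchange⇒∣A∣≤∣B∣ : Exchange 𝓑 → ∀ k {A B} → A ∈ᶠ 𝓑 → B ∈ᶠ 𝓑 → ∣ A ─ B ∣ ≤ k → ∣ A ∣ ≤ ∣ B ∣
  exchange⇒∣A∣≤∣B∣ ex k {A} {B} A∈ B∈ ∣A─B∣≤k with Fin.any? (λ x → x ∈? (A ─ B))
  ... | no A─B-empty = p⊆q⇒∣p∣≤∣q∣ A⊆B
    where
    A⊆B : A ⊆ B
    A⊆B {x} x∈A with x ∈? B
    ... | yes x∈B = x∈B
    ... | no x∉B = contradiction (x , x∈p∧x∉q⇒x∈p─q x∈A x∉B) A─B-empty
  exchange⇒∣A∣≤∣B∣ ex zero {A} {B} A∈ B∈ ∣A─B∣≤k | yes (x , x∈) =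
    contradiction (subst (_≤ 0) (∣S∣≡1+∣S-x∣ x∈) ∣A─B∣≤k) λ ()
  exchange⇒∣A∣≤∣B∣ ex (suc k) {A} {B} A∈ B∈ ∣A─B∣≤k | yes (x , x∈)
    with y , y∈B , y∉A , A′∈ ← ex A B A∈ B∈ x (p─q⊆p A B x∈) (x∈p─q⇒x∉q A B x∈) = begin
    ∣ A ∣               ≡⟨ ∣S∣≡1+∣S-x∣ (p─q⊆p A B x∈) ⟩
    suc ∣ A - x ∣       ≡⟨ ∣⁅x⁆∪S∣≡1+∣S∣ (y∉A ∘ proj₁ ∘ ∈--⁻) ⟨
    ∣ ⁅ y ⁆ ∪ (A - x) ∣ ≡⟨ cong ∣_∣ (∪-comm ⁅ y ⁆ (A - x)) ⟩
    ∣ A′ ∣              ≤⟨ exchange⇒∣A∣≤∣B∣ ex k A′∈ B∈ (ℕ.≤-pred (ℕ.≤-trans (p⊂q⇒∣p∣<∣q∣ A′─B⊂A─B) ∣A─B∣≤k)) ⟩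
    ∣ B ∣               ∎
    where
    open ℕ.≤-Reasoning
    A′ = (A - x) ∪ ⁅ y ⁆
    A′─B⊂A─B : (A′ ─ B) ⊂ (A ─ B)
    A′─B⊂A─B = included , x , x∈ , excluded
      where
      included : (A′ ─ B) ⊆ (A ─ B)
      included z∈ with ∈-∪⁻ (p─q⊆p A′ B z∈)
      ... | inj₁ z∈A-x = x∈p∧x∉q⇒x∈p─q (proj₁ (∈--⁻ z∈A-x)) (x∈p─q⇒x∉q A′ B z∈)
      ... | inj₂ z∈y = contradiction (subst (_∈ B) (sym (∈⁅⁆⁻ z∈y)) y∈B) (x∈p─q⇒x∉q A′ B z∈)
      excluded : x ∉ A′ ─ B
      excluded x∈′ with ∈-∪⁻ (p─q⊆p A′ B x∈′)
      ... | inj₁ x∈A-x = x∉S-x A x x∈A-x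
      ... | inj₂ x∈y = contradiction (subst (_∈ B) (sym (∈⁅⁆⁻ x∈y)) y∈B) (x∈p─q⇒x∉q A B x∈)

  -- The rank bounds the size of every basis from above. It is attained inside some basis, and
  -- equicardinality carries this lower bound over to `B`.
  rank₃⇒uniform₃ : IsMatroidOfRank 𝓑 3 → Uniform₃
  rank₃⇒uniform₃ ((_ , ex) , rank≡3) {B} B∈
    with I , I⊆⊤ , (A , A∈ , I⊆A) , 3≤∣I∣ ← rank-attained (ℕ.≤-reflexive (sym rank≡3)) = ℕ.≤-antisym
    (subst (∣ B ∣ ≤_) rank≡3 (≤-rank {I = B} ⊆⊤ (B , B∈ , id)))
    (ℕ.≤-trans 3≤∣I∣ (ℕ.≤-trans (p⊆q⇒∣p∣≤∣q∣ I⊆A) (exchange⇒∣A∣≤∣B∣ ex _ A∈ B∈ ℕ.≤-refl)))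

  PartialTripleSystem : Set
  PartialTripleSystem = ∀ {a b c d} → a ≢ b → a ≢ c → b ≢ c → a ≢ d → b ≢ d →
    Collinear a b c → Collinear a b d → c ≡ d

  -- Triples with coinciding points are never bases, so the axiom need only be checked on four
  -- distinct points.
  distinct⇒line : Uniform₃ →
    (∀ {a b u v} → a ≢ b → a ≢ u → b ≢ u → a ≢ v → b ≢ v → u ≢ v →
      Collinear a b u → Collinear a b v → Collinear a u v) → TwoPointsSpanLine
  distinct⇒line uniform line {a} {b} {u} {v} a≢b abu abv auv∈
    with ∣triple∣≡3⇒distinct (uniform auv∈)
  ... | a≢u , a≢v , u≢v with b Fin.≟ u | b Fin.≟ v
  ...   | yes refl | _ = abv auv∈
  ...   | no _ | yes refl = collinear-swapʳ abu auv∈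
  ...   | no b≢u | no b≢v = line a≢b a≢u b≢u a≢v b≢v u≢v abu abv auv∈

  partialTripleSystem⇒line : Uniform₃ → PartialTripleSystem → TwoPointsSpanLine
  partialTripleSystem⇒line uniform pts = distinct⇒line uniform
    λ a≢b a≢u b≢u a≢v b≢v u≢v abu abv →
      contradiction (pts a≢b a≢u b≢u a≢v b≢v abu abv) u≢v

  -- Suppose `c` and `d` differ. Then `abc` is a circuit-hyperplane: minimality extends the pair
  -- `ab` to a basis `abw`, and flatness yields a basis `I` inside `abcd`. Exchanging `w` for a
  -- point of `I` would make `abc` or `abd` a basis.
  sparsePaving⇒partialTripleSystem : SparsePaving 𝓑 3 → PartialTripleSystem
  sparsePaving⇒partialTripleSystem (matroid@((_ , ex) , rank≡3) , sparse)
    {a} {b} {c} {d} a≢b a≢c b≢c a≢d b≢d abc abd with c Fin.≟ d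
  ... | yes c≡d = c≡d
  ... | no c≢d with sparse (triple a b c) (∣triple∣≡3 a≢b a≢c b≢c)
  ...   | inj₁ abc∈ = contradiction abc∈ abc
  ...   | inj₂ ((_ , minimal) , flat , rank-S)
    with B , B∈ , ab⊆B ← minimal (⁅ a ⁆ ∪ ⁅ b ⁆)
      ( [ (λ x∈a → subst (_∈ triple a b c) (sym (∈⁅⁆⁻ x∈a)) ∈-triple₁)
        , (λ x∈b → subst (_∈ triple a b c) (sym (∈⁅⁆⁻ x∈b)) ∈-triple₂) ]′ ∘ ∈-∪⁻
      , c , ∈-triple₃
      , [ ≢-sym a≢c ∘ ∈⁅⁆⁻ , ≢-sym b≢c ∘ ∈⁅⁆⁻ ]′ ∘ ∈-∪⁻)
    with w , refl , a≢w , b≢w ← ∣S∣≡3⇒triple₂ (rank₃⇒uniform₃ matroid B∈)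
      (ab⊆B (x∈p∪q⁺ (inj₁ (x∈⁅x⁆ a)))) (ab⊆B (x∈p∪q⁺ (inj₂ (x∈⁅x⁆ b)))) a≢b
    with I , I⊆ , (B′ , B′∈ , I⊆B′) , 3≤∣I∣ ← rank-attained {triple a b c ∪ ⁅ d ⁆} {2}
      (subst (_≤ rank 𝓑 (triple a b c ∪ ⁅ d ⁆)) (trans rank-S rank≡3) (flat d
        ([ ≢-sym a≢d , [ ≢-sym b≢d , ≢-sym c≢d ]′ ]′ ∘ ∈-triple⁻)))
    -- An independent set with three elements is itself a basis.
    with refl ← S⊆T∧∣T∣≤∣S∣⇒S≡T I⊆B′
      (ℕ.≤-trans (ℕ.≤-reflexive (rank₃⇒uniform₃ matroid B′∈)) 3≤∣I∣)
    = contradiction (ex (triple a b w) I B∈ B′∈ w ∈-triple₃ w∉I) no-exchange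
    where
    in-abcd : ∀ {y} → y ∈ I → y ≢ a → y ≢ b → y ≡ c ⊎ y ≡ d
    in-abcd y∈ y≢a y≢b with ∈-∪⁻ (I⊆ y∈)
    ... | inj₂ y∈d = inj₂ (∈⁅⁆⁻ y∈d)
    ... | inj₁ y∈abc with ∈-triple⁻ y∈abc
    ...   | inj₁ y≡a = contradiction y≡a y≢a
    ...   | inj₂ (inj₁ y≡b) = contradiction y≡b y≢b
    ...   | inj₂ (inj₂ y≡c) = inj₁ y≡c

    w∉I : w ∉ I
    w∉I w∈ with in-abcd w∈ (≢-sym a≢w) (≢-sym b≢w)
    ... | inj₁ refl = abc B∈
    ... | inj₂ refl = abd B∈

    no-exchange : ¬ (∃[ y ] (y ∈ I × y ∉ triple a b w × ((triple a b w - w) ∪ ⁅ y ⁆) ∈ᶠ 𝓑))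
    no-exchange (y , y∈ , y∉ , aby) with in-abcd y∈ (λ { refl → y∉ ∈-triple₁ }) (λ { refl → y∉ ∈-triple₂ })
      | subst (_∈ᶠ 𝓑) (trans
          (cong (λ S → (S - w) ∪ ⁅ y ⁆) (trans (triple-swapʳ a b w) (triple-swapˡ a w b)))
          (triple-exchange (≢-sym a≢w) (≢-sym b≢w))) aby
    ... | inj₁ refl | aby∈ = abc aby∈
    ... | inj₂ refl | aby∈ = abd aby∈

  sparsePaving⇒paving : SparsePaving 𝓑 3 → Paving 𝓑 3
  sparsePaving⇒paving sp@(matroid@(((_ , B∈) , _) , _) , _) = paving₃ uniform
    (partialTripleSystem⇒line uniform (sparsePaving⇒partialTripleSystem sp)) B∈
    where
    uniform : Uniform₃
    uniform = rank₃⇒uniform₃ matroid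

-- Adding a line of four points

_∈range_ : ∀ {k n} → Fin n → (Fin k → Fin n) → Set
x ∈range q = ∃[ i ] x ≡ q i

_∈range?_ : ∀ {k n} (x : Fin n) (q : Fin k → Fin n) → Dec (x ∈range q)
x ∈range? q = Fin.any? λ i → x Fin.≟ q i

covered⇒collision : ∀ {k l n} (r : Fin l → Fin n) (q : Fin k → Fin n) → k < l →
  (∀ i → r i ∈range q) → ∃[ i ] ∃[ j ] (i Fin.< j × r i ≡ r j)
covered⇒collision r q k<l cover with Fin.pigeonhole k<l (proj₁ ∘ cover)
... | i , j , i<j , eq =
  i , j , i<j , trans (proj₂ (cover i)) (trans (cong q eq) (sym (proj₂ (cover j))))

∃∉range : ∀ {k n} (q : Fin k → Fin n) → k < n → ∃[ x ] ¬ (x ∈range q)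
∃∉range q k<n with Fin.any? (λ x → ¬? (x ∈range? q))
... | yes found = found
... | no none with i , j , i<j , eq ← covered⇒collision id q k<n
  (λ x → decidable-stable (x ∈range? q) (λ x∉ → none (x , x∉))) = contradiction eq (Fin.<⇒≢ i<j)

-- Adding `q i` to the points of `r` gives one point more than `q` has positions, so two of them
-- coincide; as `r` is injective, one of the two is `q i`.
range-⊇ : ∀ {k n} {r q : Fin k → Fin n} → Injective _≡_ _≡_ r →
  (∀ i → r i ∈range q) → ∀ i → q i ∈range r
range-⊇ {k} {n} {r} {q} r-injective r⊆q i with q i ∈range? r
... | yes qi∈r = qi∈r
... | no qi∉r with covered⇒collision r⁺ q (ℕ.n<1+n k) cover
  where
  r⁺ : Fin (suc k) → Fin n
  r⁺ zero    = q i
  r⁺ (suc j) = r j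
  cover : ∀ j → r⁺ j ∈range q
  cover zero    = i , refl
  cover (suc j) = r⊆q j
...   | zero  , suc l , _ , eq = l , eq
...   | suc j , suc l , j<l , eq = contradiction (cong suc (r-injective eq)) (Fin.<⇒≢ j<l)

module _ {n : ℕ} (q : Fin 4 → Fin n) where

  Inside : Subset n → Set
  Inside S = ∀ x → x ∈ S → x ∈range q

  inside? : ∀ S → Dec (Inside S)
  inside? S = Fin.all? λ x → (x ∈? S) →-dec (x ∈range? q)

  MeetsTwice : Subset n → Set
  MeetsTwice S = ∃[ u ] ∃[ v ] (u ≢ v × u ∈ S × v ∈ S × u ∈range q × v ∈range q)

  meetsTwice? : ∀ S → Dec (MeetsTwice S)
  meetsTwice? S = Fin.any? λ u → Fin.any? λ v →
    ¬? (u Fin.≟ v) ×-dec (u ∈? S) ×-dec (v ∈? S) ×-dec (u ∈range? q) ×-dec (v ∈range? q)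

  inside⇒meetsTwice : ∀ {S} → ∣ S ∣ ≡ 3 → Inside S → MeetsTwice S
  inside⇒meetsTwice {S} eq within with x , x∈ ← ∣S∣≡1+k⇒nonempty {S = S} eq
    with y , _ , refl , x≢y , _ ← ∣S∣≡3⇒triple {S = S} eq x∈ =
    x , y , x≢y , ∈-triple₁ , ∈-triple₂ , within x ∈-triple₁ , within y ∈-triple₂

  module _ (𝓑 : Family n) where

    -- The last alternative turns the nonbases that share two points with q into bases.
    LineBasis : Subset n → Set
    LineBasis S = ∣ S ∣ ≡ 3 × ¬ Inside S × (S ∈ᶠ 𝓑 ⊎ MeetsTwice S)

    lineBasis? : ∀ S → Dec (LineBasis S)
    lineBasis? S = (∣ S ∣ ℕ.≟ 3) ×-dec ¬? (inside? S) ×-dec ((S ∈ᶠ? 𝓑) ⊎-dec meetsTwice? S)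

    addLine : Family n
    addLine = family lineBasis?

    -- These two triples are enough to determine the line added by addLine, see line-unique.
    IsLine : Set
    IsLine = Injective _≡_ _≡_ q × Collinear 𝓑 (q 0F) (q 1F) (q 2F) × Collinear 𝓑 (q 0F) (q 1F) (q 3F)

module _ {n : ℕ} {𝓑 : Family n} (uniform : Uniform₃ 𝓑) (pts : PartialTripleSystem 𝓑)
  {q : Fin 4 → Fin n} (q-injective : Injective _≡_ _≡_ q) where

  private
    𝓑′ : Family n
    𝓑′ = addLine q 𝓑

  addLine-uniform : Uniform₃ 𝓑′
  addLine-uniform = proj₁ ∘ ∈-family⁻ (lineBasis? q 𝓑)

  inside⇒collinear : ∀ {a b c} → a ∈range q → b ∈range q → c ∈range q → Collinear 𝓑′ a b c
  inside⇒collinear {a} {b} {c} a∈ b∈ c∈ abc∈ = proj₁ (proj₂ (∈-family⁻ (lineBasis? q 𝓑) abc∈)) within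
    where
    within : Inside q (triple a b c)
    within x x∈ with ∈-triple⁻ x∈
    ... | inj₁ refl = a∈
    ... | inj₂ (inj₁ refl) = b∈
    ... | inj₂ (inj₂ refl) = c∈

  -- The new nonbases are the triples inside `q` and the old nonbases that do not meet `q` twice. In
  -- the second case only the pair `a`, `b` is recorded, as this is the pair shared by two triples
  -- below.
  collinear⁻ : ∀ {a b c} → a ≢ b → a ≢ c → b ≢ c → Collinear 𝓑′ a b c →
    (a ∈range q × b ∈range q × c ∈range q) ⊎ (Collinear 𝓑 a b c × ¬ (a ∈range q × b ∈range q))
  collinear⁻ {a} {b} {c} a≢b a≢c b≢c abc with inside? q (triple a b c)
  ... | yes within = inj₁ (within a ∈-triple₁ , within b ∈-triple₂ , within c ∈-triple₃)
  ... | no ¬inside = inj₂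
    ( (λ abc∈ → abc (basis (inj₁ abc∈)))
    , (λ { (a∈ , b∈) → abc (basis (inj₂ (a , b , a≢b , ∈-triple₁ , ∈-triple₂ , a∈ , b∈))) }))
    where
    basis : triple a b c ∈ᶠ 𝓑 ⊎ MeetsTwice q (triple a b c) → triple a b c ∈ᶠ 𝓑′
    basis which = ∈-family⁺ (lineBasis? q 𝓑) (∣triple∣≡3 a≢b a≢c b≢c , ¬inside , which)

  addLine-line : TwoPointsSpanLine 𝓑′
  addLine-line = distinct⇒line 𝓑′ addLine-uniform spans
    where
    spans : ∀ {a b u v} → a ≢ b → a ≢ u → b ≢ u → a ≢ v → b ≢ v → u ≢ v →
      Collinear 𝓑′ a b u → Collinear 𝓑′ a b v → Collinear 𝓑′ a u v
    spans a≢b a≢u b≢u a≢v b≢v u≢v abu abv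
      -- The shared pair lies in `q` either for both triples or for neither; two old nonbases
      -- through the same pair have the same third point.
      with collinear⁻ a≢b a≢u b≢u abu | collinear⁻ a≢b a≢v b≢v abv
    ... | inj₁ (a∈ , _ , u∈) | inj₁ (_ , _ , v∈) = inside⇒collinear a∈ u∈ v∈
    ... | inj₁ (a∈ , b∈ , _) | inj₂ (_ , ¬ab∈) = contradiction (a∈ , b∈) ¬ab∈
    ... | inj₂ (_ , ¬ab∈) | inj₁ (a∈ , b∈ , _) = contradiction (a∈ , b∈) ¬ab∈
    ... | inj₂ (abu′ , _) | inj₂ (abv′ , _) =
      contradiction (pts a≢b a≢u b≢u a≢v b≢v abu′ abv′) u≢v

  private
    q-≢ : ∀ {i j} → i ≢ j → q i ≢ q j
    q-≢ i≢j = i≢j ∘ q-injective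

  addLine-isLine : IsLine q 𝓑′
  addLine-isLine = q-injective ,
    inside⇒collinear (0F , refl) (1F , refl) (2F , refl) ,
    inside⇒collinear (0F , refl) (1F , refl) (3F , refl)

  -- A point `w` off the line exists because there are more than four points. Together with two
  -- points of the line it forms a basis.
  addLine-paving : 4 < n → Paving 𝓑′ 3
  addLine-paving 4<n with w , w∉q ← ∃∉range q 4<n =
    paving₃ 𝓑′ addLine-uniform addLine-line {triple (q 0F) (q 1F) w} (∈-family⁺ (lineBasis? q 𝓑)
      ( ∣triple∣≡3 {a = q 0F} {q 1F} {w} (q-≢ λ ()) (λ eq → w∉q (0F , sym eq)) (λ eq → w∉q (1F , sym eq))
      , (λ within → w∉q (within w ∈-triple₃))
      , inj₂ (q 0F , q 1F , q-≢ (λ ()) , ∈-triple₁ , ∈-triple₂ , (0F , refl) , (1F , refl))))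

  addLine-¬sparsePaving : ¬ SparsePaving 𝓑′ 3
  addLine-¬sparsePaving sparse = contradiction (q-injective {2F} {3F} q₂≡q₃) λ ()
    where
    q₂≡q₃ : q 2F ≡ q 3F
    q₂≡q₃ = sparsePaving⇒partialTripleSystem 𝓑′ sparse {q 0F} {q 1F} {q 2F} {q 3F}
      (q-≢ λ ()) (q-≢ λ ()) (q-≢ λ ()) (q-≢ λ ()) (q-≢ λ ())
      (proj₁ (proj₂ addLine-isLine)) (proj₂ (proj₂ addLine-isLine))

  -- The two given triples share `r 0F` and `r 1F`. As in `addLine-line`, both lie inside `q` or
  -- both are old nonbases, and the latter would identify `r 2F` with `r 3F`.
  line-unique : ∀ {r} → IsLine r 𝓑′ → ∀ i → r i ∈range q
  line-unique {r} (r-injective , c₁ , c₂) = all-in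
    where
    r-≢ : ∀ {i j} → i ≢ j → r i ≢ r j
    r-≢ i≢j = i≢j ∘ r-injective
    all-in : ∀ i → r i ∈range q
    all-in with collinear⁻ (r-≢ λ ()) (r-≢ λ ()) (r-≢ λ ()) c₁
                 | collinear⁻ (r-≢ λ ()) (r-≢ λ ()) (r-≢ λ ()) c₂
    ... | inj₁ (r₀∈ , r₁∈ , r₂∈) | inj₁ (_ , _ , r₃∈) = λ where
      0F → r₀∈
      1F → r₁∈
      2F → r₂∈
      3F → r₃∈
    ... | inj₁ (r₀∈ , r₁∈ , _) | inj₂ (_ , ¬r₀₁∈) = contradiction (r₀∈ , r₁∈) ¬r₀₁∈
    ... | inj₂ (_ , ¬r₀₁∈) | inj₁ (r₀∈ , r₁∈ , _) = contradiction (r₀∈ , r₁∈) ¬r₀₁∈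
    ... | inj₂ (c₁′ , _) | inj₂ (c₂′ , _) with () ← r-injective
      (pts (r-≢ λ ()) (r-≢ λ ()) (r-≢ λ ()) (r-≢ λ ()) (r-≢ λ ()) c₁′ c₂′)

-- Finding the added line and undoing its addition.

module _ {n : ℕ} where

  injective? : ∀ {k} (q : Fin k → Fin n) → Dec (∀ i j → q i ≡ q j → i ≡ j)
  injective? q = Fin.all? λ i → Fin.all? λ j → (q i Fin.≟ q j) →-dec (i Fin.≟ j)

  isLine? : ∀ q (𝓑 : Family n) → Dec (IsLine q 𝓑)
  isLine? q 𝓑 with injective? q
    | ¬? (triple (q 0F) (q 1F) (q 2F) ∈ᶠ? 𝓑) | ¬? (triple (q 0F) (q 1F) (q 3F) ∈ᶠ? 𝓑)
  ... | yes inj | yes c₁ | yes c₂ = yes ((λ {i} {j} → inj i j) , c₁ , c₂)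
  ... | no ¬inj | _ | _ = no λ { (inj , _) → ¬inj λ _ _ → inj }
  ... | _ | no ¬c₁ | _ = no (¬c₁ ∘ proj₁ ∘ proj₂)
  ... | _ | _ | no ¬c₂ = no (¬c₂ ∘ proj₂ ∘ proj₂)

  -- The search for a line runs over coded tuples, and decoding returns a tuple only up to pointwise
  -- equality.
  IsLine-resp : ∀ {q r} {𝓑 : Family n} → q ≗ r → IsLine q 𝓑 → IsLine r 𝓑
  IsLine-resp {q} {r} {𝓑} q≗r (inj , c₁ , c₂) =
    (λ {i} {j} eq → inj (trans (q≗r i) (trans eq (sym (q≗r j))))) ,
    collinear-resp 0F 1F 2F c₁ , collinear-resp 0F 1F 3F c₂
    where
    collinear-resp : ∀ i j k → Collinear 𝓑 (q i) (q j) (q k) → Collinear 𝓑 (r i) (r j) (r k)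
    collinear-resp i j k c rewrite sym (q≗r i) | sym (q≗r j) | sym (q≗r k) = c

  opaque

    -- Some four points forming a line of 𝓑 when there are such points, a junk value otherwise.
    findLine : Family n → Fin n → Fin 4 → Fin n
    findLine 𝓑 v with Fin.any? {n = n ^ 4} (λ k → isLine? (finToFun k) 𝓑)
    ... | yes (k , _) = finToFun k
    ... | no _ = λ _ → v

    findLine-isLine : ∀ {q} 𝓑 v → IsLine q 𝓑 → IsLine (findLine 𝓑 v) 𝓑
    findLine-isLine {q} 𝓑 v isLine with Fin.any? {n = n ^ 4} (λ k → isLine? (finToFun k) 𝓑)
    ... | yes (_ , isLine′) = isLine′
    ... | no none = contradiction
      (funToFin q , IsLine-resp {𝓑 = 𝓑} (λ i → sym (Fin.finToFun-funToFin q i)) isLine) none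

  module _ (𝓒 : Family n) (r : Fin 4 → Fin n) (R : List (Subset n)) where

    -- Triples that meet the line at most once keep their status. The others count as bases unless
    -- they are listed in `R`.
    Restored : Subset n → Set
    Restored S = ∣ S ∣ ≡ 3 × ¬ (S ∈ᶠ R) × (S ∈ᶠ 𝓒 ⊎ MeetsTwice r S)

    restored? : ∀ S → Dec (Restored S)
    restored? S = (∣ S ∣ ℕ.≟ 3) ×-dec ¬? (S ∈ᶠ? R) ×-dec ((S ∈ᶠ? 𝓒) ⊎-dec meetsTwice? r S)

    restore : Family n
    restore = family restored?

  meetsTwice-resp : ∀ {q r : Fin 4 → Fin n} {S} → (∀ i → q i ∈range r) → MeetsTwice q S → MeetsTwice r S
  meetsTwice-resp q⊆r (u , v , u≢v , u∈ , v∈ , (i , refl) , (j , refl)) =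
    u , v , u≢v , u∈ , v∈ , q⊆r i , q⊆r j

  -- R may also contain subsets of size ≠ 3, which are never bases.
  Deleted : Family n → (Fin 4 → Fin n) → List (Subset n) → Set
  Deleted 𝓑 q R = (∀ {S} → S ∈ᶠ R → ¬ (S ∈ᶠ 𝓑)) ×
    (∀ {S} → ∣ S ∣ ≡ 3 → ¬ (S ∈ᶠ 𝓑) → MeetsTwice q S → S ∈ᶠ R)

  -- `addLine` only alters triples that meet `q` twice, and among these `R` lists exactly the old
  -- nonbases. Only the point set of the line matters, so `r` may order it differently.
  restore-addLine : ∀ {𝓑} {q r : Fin 4 → Fin n} {R} → 𝓑 List.∈ families n → Uniform₃ 𝓑 →
    (∀ i → q i ∈range r) → (∀ i → r i ∈range q) → Deleted 𝓑 q R →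
    𝓑 ≡ restore (addLine q 𝓑) r R
  restore-addLine {𝓑} {q} {r} {R} 𝓑∈ uniform q⊆r r⊆q (R∌ , ∈R) = ≡family _ 𝓑∈ sound complete
    where
    sound : ∀ {S} → S ∈ᶠ 𝓑 → Restored (addLine q 𝓑) r R S
    sound {S} S∈ = uniform S∈ , (λ S∈R → R∌ S∈R S∈) , which
      where
      which : S ∈ᶠ addLine q 𝓑 ⊎ MeetsTwice r S
      which with meetsTwice? q S
      ... | yes meets = inj₂ (meetsTwice-resp q⊆r meets)
      ... | no ¬meets = inj₁ (∈-family⁺ (lineBasis? q 𝓑)
        (uniform S∈ , ¬meets ∘ inside⇒meetsTwice q (uniform S∈) , inj₁ S∈))

    complete : ∀ {S} → Restored (addLine q 𝓑) r R S → S ∈ᶠ 𝓑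
    complete {S} (∣S∣≡3 , S∉R , which) with S ∈ᶠ? 𝓑
    ... | yes S∈ = S∈
    ... | no S∉ = contradiction (∈R ∣S∣≡3 S∉ (meets which)) S∉R
      where
      meets : S ∈ᶠ addLine q 𝓑 ⊎ MeetsTwice r S → MeetsTwice q S
      meets (inj₂ m) = meetsTwice-resp r⊆q m
      meets (inj₁ S∈′) with proj₂ (proj₂ (∈-family⁻ (lineBasis? q 𝓑) S∈′))
      ... | inj₁ S∈ = contradiction S∈ S∉
      ... | inj₂ m = m

-- Recovering a sparse paving matroid

Complementary : Fin 4 → Fin 4 → Fin 4 → Fin 4 → Set
Complementary i j k l =
  k ≢ i × k ≢ j × l ≢ i × l ≢ j × k ≢ l × ∀ m → m ≡ i ⊎ m ≡ j ⊎ m ≡ k ⊎ m ≡ l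

complementary? : ∀ i j k l → Dec (Complementary i j k l)
complementary? i j k l =
  ¬? (k Fin.≟ i) ×-dec ¬? (k Fin.≟ j) ×-dec ¬? (l Fin.≟ i) ×-dec ¬? (l Fin.≟ j) ×-dec
  ¬? (k Fin.≟ l) ×-dec
  Fin.all? λ m → (m Fin.≟ i) ⊎-dec (m Fin.≟ j) ⊎-dec (m Fin.≟ k) ⊎-dec (m Fin.≟ l)

other-two : (i j : Fin 4) → i ≢ j → ∃[ k ] ∃[ l ] Complementary i j k l
other-two 0F 1F _ = 2F , 3F , from-yes (complementary? 0F 1F 2F 3F)
other-two 0F 2F _ = 1F , 3F , from-yes (complementary? 0F 2F 1F 3F)
other-two 0F 3F _ = 1F , 2F , from-yes (complementary? 0F 3F 1F 2F)
other-two 1F 0F _ = 2F , 3F , from-yes (complementary? 1F 0F 2F 3F)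
other-two 1F 2F _ = 0F , 3F , from-yes (complementary? 1F 2F 0F 3F)
other-two 1F 3F _ = 0F , 2F , from-yes (complementary? 1F 3F 0F 2F)
other-two 2F 0F _ = 1F , 3F , from-yes (complementary? 2F 0F 1F 3F)
other-two 2F 1F _ = 0F , 3F , from-yes (complementary? 2F 1F 0F 3F)
other-two 2F 3F _ = 0F , 1F , from-yes (complementary? 2F 3F 0F 1F)
other-two 3F 0F _ = 1F , 2F , from-yes (complementary? 3F 0F 1F 2F)
other-two 3F 1F _ = 0F , 2F , from-yes (complementary? 3F 1F 0F 2F)
other-two 3F 2F _ = 0F , 1F , from-yes (complementary? 3F 2F 0F 1F)
other-two 0F 0F i≢i = contradiction refl i≢i
other-two 1F 1F i≢i = contradiction refl i≢i
other-two 2F 2F i≢i = contradiction refl i≢i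
other-two 3F 3F i≢i = contradiction refl i≢i

quadruple : {A : Set} → A → A → A → A → Fin 4 → A
quadruple a b c d 0F = a
quadruple a b c d 1F = b
quadruple a b c d 2F = c
quadruple a b c d 3F = d

wlog-< : ∀ {k} {P : Fin k → Fin k → Set} → (∀ {i j} → P i j → P j i) →
  (∀ i j → i Fin.< j → P i j) → ∀ i j → i ≢ j → P i j
wlog-< P-sym P-< i j i≢j with Fin.<-cmp i j
... | tri< i<j _ _ = P-< i j i<j
... | tri≈ _ i≡j _ = contradiction i≡j i≢j
... | tri> _ _ j<i = P-sym (P-< j i j<i)

injective : ∀ {k n} {q : Fin k → Fin n} → (∀ i j → i Fin.< j → q i ≢ q j) → Injective _≡_ _≡_ q
injective {q = q} q-< {i} {j} eq = decidable-stable (i Fin.≟ j) λ i≢j →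
  wlog-< {P = λ i j → q i ≢ q j} ≢-sym q-< i j i≢j eq

module _ {n : ℕ} where

  -- The point `w` may itself be a marked point, but it can equal at most one of the two remaining
  -- ones. The position `k` avoids it and will complete the line; `l` is left over.
  fourth-point : ∀ {p : Fin 4 → Fin n} {i j} → Injective _≡_ _≡_ p → ∀ w → i ≢ j →
    ∃[ k ] ∃[ l ] (k ≢ i × k ≢ j × p k ≢ w × ∀ m → m ≡ i ⊎ m ≡ j ⊎ m ≡ k ⊎ m ≡ l)
  fourth-point {p} {i} {j} p-injective w i≢j
    with k , l , k≢i , k≢j , l≢i , l≢j , k≢l , exhaustive ← other-two i j i≢j
    with p k Fin.≟ w
  ... | no pk≢w = k , l , k≢i , k≢j , pk≢w , exhaustive
  ... | yes refl = l , k , l≢i , l≢j , ≢-sym (k≢l ∘ p-injective) ,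
    λ m → Sum.map₂ (Sum.map₂ Sum.swap) (exhaustive m)

  -- The flag `true` means that no old nonbasis meets `q` twice. Otherwise the list is `abc`, `adx`,
  -- `bdy`, `cdz`, where `q` is `abcd` and `g` starts with `x`, `y`, `z`; the entry `g 3F` is
  -- reserved for the leftover marked point.
  removed : Bool → (Fin 4 → Fin n) → (Fin 4 → Fin n) → List (Subset n)
  removed true  q g = []
  removed false q g =
    triple (q 0F) (q 1F) (q 2F) ∷ triple (q 0F) (q 3F) (g 0F) ∷
    triple (q 1F) (q 3F) (g 1F) ∷ triple (q 2F) (q 3F) (g 2F) ∷ []

  removed-cong : ∀ f {q q′ g g′} → q ≗ q′ → g ≗ g′ → removed f q g ≡ removed f q′ g′
  removed-cong true  q≗ g≗ = refl
  removed-cong false q≗ g≗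
    rewrite q≗ 0F | q≗ 1F | q≗ 2F | q≗ 3F | g≗ 0F | g≗ 1F | g≗ 2F = refl

  -- (f , k , l , m) stands for removed f q g with g = finToFun m.  The points of q and the four
  -- marked points are given by their positions k and l among g 3F and the line found in the
  -- new family; this leaves only the n ^ 4 choices of g unbounded.
  Code : Set
  Code = Bool × Fin (5 ^ 4) × Fin (5 ^ 4) × Fin (n ^ 4)

  candidates : Family n → (Fin 4 → Fin n) → Fin 5 → Fin n
  candidates 𝓒 g zero    = g 3F
  -- Here `g 3F` serves as the default value of `findLine`.
  candidates 𝓒 g (suc i) = findLine 𝓒 (g 3F) i

  decodeFamily : Family n → Code → Family n
  decodeFamily 𝓒 (f , k , l , m) = restore 𝓒 (findLine 𝓒 (g 3F))
    (removed f (candidates 𝓒 g ∘ finToFun {5} {4} k) g)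
    where
    g : Fin 4 → Fin n
    g = finToFun m

  decodePoints : Family n → Code → Fin 4 → Fin n
  decodePoints 𝓒 (f , k , l , m) = candidates 𝓒 (finToFun m) ∘ finToFun {5} {4} l

  -- Decoding is a function of `𝓒` and `code`, which is why this relation determines the matroid,
  -- and the four points pointwise.
  record Encodes (𝓑 : Family n) (p : Fin 4 → Fin n) (𝓒 : Family n) (code : Code) : Set where
    constructor encodes
    field
      family-decoded : 𝓑 ≡ decodeFamily 𝓒 code
      points-decoded : p ≗ decodePoints 𝓒 code

  module _ {𝓑 : Family n} (𝓑∈ : 𝓑 List.∈ families n)
    (uniform : Uniform₃ 𝓑) (pts : PartialTripleSystem 𝓑) where

    -- The decoder finds the line in some order `r`. By uniqueness `r` and `q` have the same points,
    -- so every point of `q` and `p` is named by a position on `r` or is `g 3F`.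
    encode-line : ∀ f {q g p} → Injective _≡_ _≡_ q → Deleted 𝓑 q (removed f q g) →
      (∀ i → p i ≡ g 3F ⊎ p i ∈range q) → ∃[ code ] Encodes 𝓑 p (addLine q 𝓑) code
    encode-line f {q} {g} {p} q-injective deleted p∈ = code , encodes family≡ points≡
      where
      𝓒 = addLine q 𝓑
      m = funToFin g
      v = finToFun {n} {4} m 3F
      r = findLine 𝓒 v

      g≗ : g ≗ finToFun m
      g≗ i = sym (Fin.finToFun-funToFin g i)

      r-isLine : IsLine r 𝓒
      r-isLine = findLine-isLine 𝓒 v (addLine-isLine uniform pts q-injective)

      r⊆q : ∀ i → r i ∈range q
      r⊆q = line-unique uniform pts q-injective r-isLine

      q⊆r : ∀ i → q i ∈range r
      q⊆r = range-⊇ (proj₁ r-isLine) r⊆q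

      labels : Fin 5 → Fin n
      labels = candidates 𝓒 (finToFun m)

      p-labels : ∀ i → p i ∈range labels
      p-labels i = [ (λ eq → zero , trans eq (g≗ 3F))
                   , (λ { (j , eq) → suc (proj₁ (q⊆r j)) , trans eq (proj₂ (q⊆r j)) }) ]′ (p∈ i)

      code : Code
      -- Positions on `r` are shifted by one, as label zero denotes `g 3F`.
      code = f , funToFin (λ i → suc (proj₁ (q⊆r i))) , funToFin (proj₁ ∘ p-labels) , m

      decode-label : ∀ {s : Fin 4 → Fin n} (label : ∀ i → s i ∈range labels) →
        s ≗ labels ∘ finToFun (funToFin (proj₁ ∘ label))
      decode-label label i = trans (proj₂ (label i))
        (cong labels (sym (Fin.finToFun-funToFin (proj₁ ∘ label) i)))

      family≡ : 𝓑 ≡ decodeFamily 𝓒 code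
      family≡ = trans (restore-addLine 𝓑∈ uniform q⊆r r⊆q deleted)
        (cong (restore 𝓒 r) (removed-cong f
          (decode-label (λ i → suc (proj₁ (q⊆r i)) , proj₂ (q⊆r i))) g≗))

      points≡ : p ≗ decodePoints 𝓒 code
      points≡ = decode-label p-labels

    third-point : ∀ {a b} → a ≢ b → ∃[ x ]
      (Collinear 𝓑 a b x × ∀ {y} → a ≢ y → b ≢ y → Collinear 𝓑 a b y → y ≡ x)
    third-point {a} {b} a≢b with Fin.any? (λ x →
      ¬? (a Fin.≟ x) ×-dec ¬? (b Fin.≟ x) ×-dec ¬? (triple a b x ∈ᶠ? 𝓑))
    ... | yes (x , a≢x , b≢x , abx) = x , abx , λ a≢y b≢y aby → pts a≢b a≢y b≢y a≢x b≢x aby abx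
    -- The default `a` gives a degenerate triple, which is never a basis and so may be listed as
    -- removed.
    ... | no none = a , (λ aba∈ → proj₁ (proj₂ (∣triple∣≡3⇒distinct (uniform aba∈))) refl) ,
      λ a≢y b≢y aby → contradiction (_ , a≢y , b≢y , aby) none

    Covered : (Fin 4 → Fin n) → Set
    Covered p = ∃[ i ] ∃[ j ] ∃[ w ] (p i ≢ p j × p i ≢ w × p j ≢ w × Collinear 𝓑 (p i) (p j) w)

    covered? : ∀ p → Dec (Covered p)
    covered? p = Fin.any? λ i → Fin.any? λ j → Fin.any? λ w →
      ¬? (p i Fin.≟ p j) ×-dec ¬? (p i Fin.≟ w) ×-dec ¬? (p j Fin.≟ w) ×-dec
      ¬? (triple (p i) (p j) w ∈ᶠ? 𝓑)

    uncovered-deleted : ∀ {p} g → ¬ Covered p → Deleted 𝓑 p (removed true p g)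
    uncovered-deleted g ¬covered = (λ ()) , λ where
      ∣S∣≡3 S∉ (_ , _ , u≢v , u∈ , v∈ , (i , refl) , (j , refl)) →
        let w , S≡ , u≢w , v≢w = ∣S∣≡3⇒triple₂ ∣S∣≡3 u∈ v∈ u≢v
        in ⊥-elim (¬covered (i , j , w , u≢v , u≢w , v≢w , S∉ ∘ subst (_∈ᶠ 𝓑) (sym S≡)))

    -- A nonbasis through two of `a`, `b`, `c` is `abc` itself; one through `d` and another of the
    -- four points is determined by its third point.
    covered-deleted : ∀ {a b c d} → a ≢ b → a ≢ c → b ≢ c → d ≢ a → d ≢ b → d ≢ c →
      Collinear 𝓑 a b c → ∀ v → ∃[ g ]
        (g 3F ≡ v × Deleted 𝓑 (quadruple a b c d) (removed false (quadruple a b c d) g))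
    covered-deleted {a} {b} {c} {d} a≢b a≢c b≢c d≢a d≢b d≢c abc v
      with x , adx , x-unique ← third-point (≢-sym d≢a)
      with y , bdy , y-unique ← third-point (≢-sym d≢b)
      with z , cdz , z-unique ← third-point (≢-sym d≢c)
      = g , refl , R∌ , λ { ∣S∣≡3 S∉ (_ , _ , u≢v , u∈ , v∈ , (i , refl) , (j , refl)) →
          -- The claim is symmetric in the two shared points, which leaves the six pairs with `i`
          -- below `j`.
          wlog-< {P = λ i j → ∀ {S} → ∣ S ∣ ≡ 3 → ¬ (S ∈ᶠ 𝓑) → q i ∈ S → q j ∈ S → q i ≢ q j → S ∈ᶠ R}
            (λ P ∣S∣≡3 S∉ u∈ v∈ u≢v → P ∣S∣≡3 S∉ v∈ u∈ (≢-sym u≢v)) ∈R i j (λ { refl → u≢v refl })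
            ∣S∣≡3 S∉ u∈ v∈ u≢v }
      where
      q g : Fin 4 → Fin n
      q = quadruple a b c d
      g = quadruple x y z v

      R : List (Subset n)
      R = removed false q g

      R∌ : ∀ {S} → S ∈ᶠ R → ¬ (S ∈ᶠ 𝓑)
      R∌ (here refl) = abc
      R∌ (there (here refl)) = adx
      R∌ (there (there (here refl))) = bdy
      R∌ (there (there (there (here refl)))) = cdz

      ∈R : ∀ i j → i Fin.< j → ∀ {S} → ∣ S ∣ ≡ 3 → ¬ (S ∈ᶠ 𝓑) → q i ∈ S → q j ∈ S → q i ≢ q j → S ∈ᶠ R
      ∈R i j i<j ∣S∣≡3 S∉ u∈ v∈ u≢v with ∣S∣≡3⇒triple₂ ∣S∣≡3 u∈ v∈ u≢v
      ∈R 0F 1F _ _ S∉ _ _ _ | w , refl , u≢w , v≢w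
        with refl ← pts a≢b u≢w v≢w a≢c b≢c S∉ abc = here refl
      ∈R 0F 2F _ _ S∉ _ _ _ | w , refl , u≢w , v≢w
        with refl ← pts a≢c u≢w v≢w a≢b (≢-sym b≢c) S∉ (collinear-swapʳ 𝓑 abc) =
        here (triple-swapʳ a c b)
      ∈R 1F 2F _ _ S∉ _ _ _ | w , refl , u≢w , v≢w
        with refl ← pts b≢c u≢w v≢w (≢-sym a≢b) (≢-sym a≢c) S∉ (collinear-swapʳ 𝓑 (collinear-swapˡ 𝓑 abc)) =
        here (trans (triple-swapʳ b c a) (triple-swapˡ b a c))
      ∈R 0F 3F _ _ S∉ _ _ _ | w , refl , u≢w , v≢w
        with refl ← x-unique u≢w v≢w S∉ = there (here refl)
      ∈R 1F 3F _ _ S∉ _ _ _ | w , refl , u≢w , v≢w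
        with refl ← y-unique u≢w v≢w S∉ = there (there (here refl))
      ∈R 2F 3F _ _ S∉ _ _ _ | w , refl , u≢w , v≢w
        with refl ← z-unique u≢w v≢w S∉ = there (there (there (here refl)))
      ∈R 1F 1F (s≤s ()) _ _ _ _ _ | _
      ∈R 2F 1F (s≤s ()) _ _ _ _ _ | _
      ∈R 3F 1F (s≤s ()) _ _ _ _ _ | _
      ∈R 2F 2F (s≤s (s≤s ())) _ _ _ _ _ | _
      ∈R 3F 2F (s≤s (s≤s ())) _ _ _ _ _ | _
      ∈R 3F 3F (s≤s (s≤s (s≤s ()))) _ _ _ _ _ | _

    encode : ∀ p → Injective _≡_ _≡_ p →
      ∃[ q ] (Injective _≡_ _≡_ q × ∃[ code ] Encodes 𝓑 p (addLine q 𝓑) code)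
    encode p p-injective with covered? p
    ... | no ¬covered = p , p-injective ,
      -- No triple is removed and all marked points lie on the line, so `g` is filled with an
      -- arbitrary point.
      encode-line true {p} {λ _ → p 0F} {p} p-injective (uncovered-deleted (λ _ → p 0F) ¬covered) (λ i → inj₂ (i , refl))
    ... | yes (i , j , w , pi≢pj , pi≢w , pj≢w , ijw)
      with k , l , k≢i , k≢j , pk≢w , exhaustive ← fourth-point p-injective w (λ { refl → pi≢pj refl })
      with g , g₃≡ , deleted ← covered-deleted pi≢pj pi≢w pj≢w
        (k≢i ∘ p-injective) (k≢j ∘ p-injective) pk≢w ijw (p l) =
      q , q-injective , encode-line false {q} {g} {p} q-injective deleted p∈
      where
      q : Fin 4 → Fin n
      q = quadruple (p i) (p j) w (p k)

      q-injective : Injective _≡_ _≡_ q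
      q-injective = injective λ where
        0F 1F _ → pi≢pj
        0F 2F _ → pi≢w
        1F 2F _ → pj≢w
        0F 3F _ → ≢-sym (k≢i ∘ p-injective)
        1F 3F _ → ≢-sym (k≢j ∘ p-injective)
        2F 3F _ → ≢-sym pk≢w
        1F 1F (s≤s ())
        2F 1F (s≤s ())
        3F 1F (s≤s ())
        2F 2F (s≤s (s≤s ()))
        3F 2F (s≤s (s≤s ()))
        3F 3F (s≤s (s≤s (s≤s ())))

      p∈ : ∀ m → p m ≡ g 3F ⊎ p m ∈range q
      p∈ m with exhaustive m
      ... | inj₁ refl = inj₂ (0F , refl)
      ... | inj₂ (inj₁ refl) = inj₂ (1F , refl)
      ... | inj₂ (inj₂ (inj₁ refl)) = inj₂ (3F , refl)
      ... | inj₂ (inj₂ (inj₂ refl)) = inj₁ (sym g₃≡)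

-- Counting

funToFin-cong : ∀ {k n} {f g : Fin k → Fin n} → f ≗ g → funToFin f ≡ funToFin g
funToFin-cong {zero}  f≗g = refl
funToFin-cong {suc k} f≗g = cong₂ combine (f≗g zero) (funToFin-cong (f≗g ∘ suc))

finToFun-injective : ∀ {k n} (i j : Fin (n ^ k)) → finToFun {n} {k} i ≗ finToFun j → i ≡ j
finToFun-injective {k} {n} i j eq = trans (sym (Fin.funToFin-finToFin {k} {n} i))
  (trans (funToFin-cong eq) (Fin.funToFin-finToFin {k} {n} j))

module _ (k m : ℕ) {n : ℕ} (mk≤n : m * k ≤ n) where

  private
    index : Fin (m ^ k) → Fin k → Fin (m * k)
    index j i = combine (finToFun j i) i

  -- The i-th point is congruent to i modulo k, which makes the points distinct.
  points : Fin (m ^ k) → Fin k → Fin n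
  points j i = inject≤ (index j i) mk≤n

  points-injective : ∀ j → Injective _≡_ _≡_ (points j)
  points-injective j {i} {i′} eq = Fin.combine-injectiveʳ {m} {k} _ i _ i′
    (Fin.inject≤-injective mk≤n mk≤n (index j i) (index j i′) eq)

  points-determine : ∀ j j′ → points j ≗ points j′ → j ≡ j′
  points-determine j j′ eq = finToFun-injective j j′ λ i → Fin.combine-injectiveˡ {m} {k} _ i _ i
    (Fin.inject≤-injective mk≤n mk≤n (index j i) (index j′ i) (eq i))

sparsePavings nonSparsePavings : ∀ n → List (Family n)
sparsePavings n = filter (λ 𝓑 → sparsePaving? 𝓑 3) (families n)
nonSparsePavings n = filter (λ 𝓑 → paving? 𝓑 3 ×-dec ¬? (sparsePaving? 𝓑 3)) (families n)

p≡s+nonSparse : ∀ n → p n 3 ≡ s n 3 + length (nonSparsePavings n)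
p≡s+nonSparse n = length-filter-split (λ 𝓑 → paving? 𝓑 3) (λ 𝓑 → sparsePaving? 𝓑 3)
  (sparsePaving⇒paving _) (families n)

-- The witness is the uniform matroid, which has no nonbases of size three. This keeps the ratio
-- away from its convention for a zero denominator.
s>0 : ∀ {n} → 3 ≤ n → 0 < s n 3
s>0 {n} 3≤n = ∈-length (∈-filter⁺ (λ 𝓑 → sparsePaving? 𝓑 3) (family∈families 3-set?) sparse)
  where
  3-set? : (S : Subset n) → Dec (∣ S ∣ ≡ 3)
  3-set? S = ∣ S ∣ ℕ.≟ 3

  𝓤 : Family n
  𝓤 = family 3-set?

  pt : Fin 3 → Fin n
  pt i = inject≤ i 3≤n

  pt-≢ : ∀ {i j} → i ≢ j → pt i ≢ pt j
  pt-≢ i≢j = i≢j ∘ Fin.inject≤-injective 3≤n 3≤n _ _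

  line : TwoPointsSpanLine 𝓤
  line = distinct⇒line 𝓤 (∈-family⁻ 3-set?) λ a≢b a≢u b≢u _ _ _ abu _ →
    contradiction (∈-family⁺ 3-set? (∣triple∣≡3 a≢b a≢u b≢u)) abu

  sparse : SparsePaving 𝓤 3
  sparse = isMatroidOfRank₃ 𝓤 (∈-family⁻ 3-set?) line {triple (pt 0F) (pt 1F) (pt 2F)}
    (∈-family⁺ 3-set? (∣triple∣≡3 {a = pt 0F} {pt 1F} {pt 2F} (pt-≢ λ ()) (pt-≢ λ ()) (pt-≢ λ ()))) ,
    λ S eq → inj₁ (∈-family⁺ 3-set? eq)

length-allFin : ∀ n → length (allFin n) ≡ n
length-allFin n = length-tabulate {n = n} id

opaque

  codes : ∀ n → List (Code {n})
  codes n = cartesianProduct (true ∷ false ∷ [])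
    (cartesianProduct (allFin (5 ^ 4)) (cartesianProduct (allFin (5 ^ 4)) (allFin (n ^ 4))))

  ∈-codes : ∀ {n} (code : Code {n}) → code List.∈ codes n
  ∈-codes (f , k , l , m) = ∈-cartesianProduct⁺ (∈-bools f)
    (∈-cartesianProduct⁺ (∈-allFin k) (∈-cartesianProduct⁺ (∈-allFin l) (∈-allFin m)))
    where
    ∈-bools : ∀ f → f List.∈ (true ∷ false ∷ [])
    ∈-bools true  = here refl
    ∈-bools false = there (here refl)

  -- The constant `2 * 5 ^ 8`, kept in symbolic form.
  codesPerTuple : ℕ
  codesPerTuple = 2 * (length (allFin (5 ^ 4)) * length (allFin (5 ^ 4)))

  length-codes : ∀ n → length (codes n) ≡ codesPerTuple * n ^ 4
  length-codes n = trans (length-product (true ∷ false ∷ []) (allFin (5 ^ 4)) (allFin (5 ^ 4)) (allFin (n ^ 4)))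
    (cong (codesPerTuple *_) (length-allFin (n ^ 4)))
    where
    length-product : ∀ {A B C D : Set} (ws : List A) (xs : List B) (ys : List C) (zs : List D) →
      length (cartesianProduct ws (cartesianProduct xs (cartesianProduct ys zs))) ≡
        length ws * (length xs * length ys) * length zs
    length-product ws xs ys zs = begin
      length (cartesianProduct ws (cartesianProduct xs (cartesianProduct ys zs)))
        ≡⟨ length-cartesianProduct ws _ ⟩
      length ws * length (cartesianProduct xs (cartesianProduct ys zs))
        ≡⟨ cong (length ws *_) (length-cartesianProduct xs _) ⟩
      length ws * (length xs * length (cartesianProduct ys zs))
        ≡⟨ cong (λ k → length ws * (length xs * k)) (length-cartesianProduct ys zs) ⟩
      length ws * (length xs * (length ys * length zs))
        ≡⟨ cong (length ws *_) (ℕ.*-assoc (length xs) (length ys) (length zs)) ⟨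
      length ws * (length xs * length ys * length zs)
        ≡⟨ ℕ.*-assoc (length ws) (length xs * length ys) (length zs) ⟨
      length ws * (length xs * length ys) * length zs
        ∎
      where open ≡-Reasoning

addLine∈nonSparsePavings : ∀ {n} {𝓑 : Family n} → 4 < n → Uniform₃ 𝓑 → PartialTripleSystem 𝓑 →
  {q : Fin 4 → Fin n} → Injective _≡_ _≡_ q → addLine q 𝓑 List.∈ nonSparsePavings n
addLine∈nonSparsePavings {𝓑 = 𝓑} 4<n uniform pts {q} q-injective =
  ∈-filter⁺ (λ 𝓑 → paving? 𝓑 3 ×-dec ¬? (sparsePaving? 𝓑 3)) (family∈families (lineBasis? q 𝓑))
    (addLine-paving uniform pts q-injective 4<n , addLine-¬sparsePaving uniform pts q-injective)

module _ {m n : ℕ} (4<n : 4 < n) (4m≤n : m * 4 ≤ n) where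

  private
    Marked : Set
    Marked = Family n × Fin (m ^ 4)

    EncodedAs : Marked → Family n × Code {n} → Set
    EncodedAs (𝓑 , j) (𝓒 , code) = Encodes 𝓑 (points 4 m 4m≤n j) 𝓒 code

    EncodedAs-injective : ∀ {x x′ y} → EncodedAs x y → EncodedAs x′ y → x ≡ x′
    EncodedAs-injective {𝓑 , j} {𝓑′ , j′} (encodes 𝓑≡ p≗) (encodes 𝓑′≡ p′≗) = cong₂ _,_
      (trans 𝓑≡ (sym 𝓑′≡))
      (points-determine 4 m 4m≤n j j′ λ i → trans (p≗ i) (sym (p′≗ i)))

    marked : List Marked
    marked = cartesianProduct (sparsePavings n) (allFin (m ^ 4))

    marked-unique : Unique marked
    marked-unique = Unique.cartesianProduct⁺
      (Unique.filter⁺ (λ 𝓑 → sparsePaving? 𝓑 3) (families-unique n)) (Unique.allFin⁺ (m ^ 4))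

    encoded : List (Family n × Code {n})
    encoded = cartesianProduct (nonSparsePavings n) (codes n)

    EncodedAs-total : ∀ {x} → x List.∈ marked → ∃[ y ] y List.∈ encoded × EncodedAs x y
    EncodedAs-total {𝓑 , j} x∈ = encoding (encode 𝓑∈ uniform pts _ (points-injective 4 m 4m≤n j))
      where
      𝓑∈×sparse : 𝓑 List.∈ families n × SparsePaving 𝓑 3
      𝓑∈×sparse = ∈-filter⁻ (λ 𝓑 → sparsePaving? 𝓑 3) {xs = families n}
        (proj₁ (∈-cartesianProduct⁻ (sparsePavings n) (allFin (m ^ 4)) x∈))

      𝓑∈ : 𝓑 List.∈ families n
      𝓑∈ = proj₁ 𝓑∈×sparse

      uniform : Uniform₃ 𝓑
      uniform = rank₃⇒uniform₃ 𝓑 (proj₁ (proj₂ 𝓑∈×sparse))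

      pts : PartialTripleSystem 𝓑
      pts = sparsePaving⇒partialTripleSystem 𝓑 (proj₂ 𝓑∈×sparse)

      encoding :
        ∃[ q ] (Injective _≡_ _≡_ q × ∃[ code ] Encodes 𝓑 (points 4 m 4m≤n j) (addLine q 𝓑) code) →
        ∃[ y ] y List.∈ encoded × EncodedAs (𝓑 , j) y
      encoding (q , q-injective , code , e) = (addLine q 𝓑 , code) ,
        ∈-cartesianProduct⁺ (addLine∈nonSparsePavings 4<n uniform pts q-injective) (∈-codes code) , e

  -- Sparse paving matroids with one of `m ^ 4` marked quadruples inject into pairs of a nonsparse
  -- paving matroid and a code.
  sparse-count : s n 3 * m ^ 4 ≤ length (nonSparsePavings n) * length (codes n)
  sparse-count = begin
    length (sparsePavings n) * m ^ 4
      ≡⟨ cong (length (sparsePavings n) *_) (length-allFin (m ^ 4)) ⟨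
    length (sparsePavings n) * length (allFin (m ^ 4))
      ≡⟨ length-cartesianProduct (sparsePavings n) (allFin (m ^ 4)) ⟨
    length marked
      ≤⟨ length-≤ EncodedAs marked-unique EncodedAs-total
           (λ {x} {x′} {y} → EncodedAs-injective {x} {x′} {y}) ⟩
    length encoded
      ≡⟨ length-cartesianProduct (nonSparsePavings n) (codes n) ⟩
    length (nonSparsePavings n) * length (codes n)
      ∎
    where open ℕ.≤-Reasoning

n≤8*[n/4] : ∀ {n} → 4 ≤ n → n ≤ 8 * (n / 4)
n≤8*[n/4] {n} 4≤n = begin
  n                          ≡⟨ m≡m%n+[m/n]*n n 4 ⟩
  n % 4 + n / 4 * 4          ≤⟨ ℕ.+-monoˡ-≤ (n / 4 * 4) (ℕ.<⇒≤ (m%n<n n 4)) ⟩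
  -- As the quotient is positive, the remainder is absorbed by doubling.
  1 * 4 + n / 4 * 4          ≤⟨ ℕ.+-monoˡ-≤ (n / 4 * 4) (ℕ.*-monoˡ-≤ 4 (m≥n⇒m/n>0 4≤n)) ⟩
  n / 4 * 4 + n / 4 * 4      ≡⟨ solve 1 (λ m → m :* con 4 :+ m :* con 4 := con 8 :* m) refl (n / 4) ⟩
  8 * (n / 4)                ∎
  where
  open ℕ.≤-Reasoning
  open +-*-Solver

[m*n]^4 : ∀ m n → (m * n) ^ 4 ≡ m ^ 4 * n ^ 4
[m*n]^4 = solve 2 (λ m n → (m :* n) :^ 4 := m :^ 4 :* n :^ 4) refl
  where open +-*-Solver

-- Marked quadruples and codes both number a constant times `n ^ 4`, up to rounding, so the fourth
-- power cancels. The factor `8 ^ 4` pays for replacing `n` by `n / 4`.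
s≤D*nonSparse : ∃[ D ] (∀ {n} → 5 ≤ n → s n 3 ≤ length (nonSparsePavings n) * D)
s≤D*nonSparse = codesPerTuple * 8 ^ 4 , bound
  where
  bound : ∀ {n} → 5 ≤ n → s n 3 ≤ length (nonSparsePavings n) * (codesPerTuple * 8 ^ 4)
  bound {n} 5≤n = ℕ.*-cancelʳ-≤ (s n 3) _ (m ^ 4) {{ℕ.m^n≢0 m 4 {{ℕ.>-nonZero (m≥n⇒m/n>0 4≤n)}}}} (begin
    s n 3 * m ^ 4                  ≤⟨ sparse-count {m} 5≤n (m/n*n≤m n 4) ⟩
    N * length (codes n)           ≡⟨ cong (N *_) (length-codes n) ⟩
    N * (K * n ^ 4)                ≤⟨ ℕ.*-monoʳ-≤ N (ℕ.*-monoʳ-≤ K (ℕ.^-monoˡ-≤ 4 (n≤8*[n/4] 4≤n))) ⟩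
    N * (K * (8 * m) ^ 4)          ≡⟨ cong (λ x → N * (K * x)) ([m*n]^4 8 m) ⟩
    N * (K * (8 ^ 4 * m ^ 4))      ≡⟨ cong (N *_) (ℕ.*-assoc K (8 ^ 4) (m ^ 4)) ⟨
    N * (K * 8 ^ 4 * m ^ 4)        ≡⟨ ℕ.*-assoc N (K * 8 ^ 4) (m ^ 4) ⟨
    N * (K * 8 ^ 4) * m ^ 4        ∎)
    where
    open ℕ.≤-Reasoning
    m = n / 4
    N = length (nonSparsePavings n)
    K = codesPerTuple
    4≤n : 4 ≤ n
    4≤n = ℕ.<⇒≤ 5≤n

-- From the count to the limit inferior.

/-< : ∀ {a b c d} → a * suc d < c * suc b → + a ℚ./ suc b ℚ.< + c ℚ./ suc d
/-< {a} {b} {c} {d} lt = ℚ.toℚᵘ-cancel-< (ℚᵘ.<-respˡ-≃ (ℚᵘ.≃-sym (ℚ.toℚᵘ-fromℚᵘ (mkℚᵘ (+ a) b)))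
  (ℚᵘ.<-respʳ-≃ (ℚᵘ.≃-sym (ℚ.toℚᵘ-fromℚᵘ (mkℚᵘ (+ c) d)))
    (*<* (subst₂ ℤ._<_ (ℤ.pos-* a (suc d)) (ℤ.pos-* c (suc b)) (ℤ.+<+ lt)))))

<-ratio : ∀ {a b c d} → 0 < d → a * d < c * suc b → + a ℚ./ suc b ℚ.< ratio c d
<-ratio {a} {b} {c} {suc d} _ lt = /-< {a} {b} {c} {d} lt

-- In fractions: `N / s` is at least `1 / D`, hence above `1 / (1 + D)`, so `(s + N) / s` exceeds
-- `(2 + D) / (1 + D)`.
ratio-gap : ∀ {s N} D → 0 < s → s ≤ N * D → (2 + D) * s < (s + N) * suc D
ratio-gap {s} {zero}  D 0<s s≤ = contradiction (ℕ.≤-trans 0<s s≤) λ ()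
ratio-gap {s} {N@(suc _)} D 0<s s≤ = begin-strict
  (2 + D) * s             ≡⟨ solve 2 (λ s D → (con 2 :+ D) :* s := s :+ s :* (con 1 :+ D)) refl s D ⟩
  s + s * suc D           ≤⟨ ℕ.+-monoˡ-≤ (s * suc D) s≤ ⟩
  N * D + s * suc D       <⟨ ℕ.+-monoˡ-< (s * suc D) (ℕ.*-monoʳ-< N (ℕ.n<1+n D)) ⟩
  N * suc D + s * suc D   ≡⟨ ℕ.+-comm (N * suc D) (s * suc D) ⟩
  s * suc D + N * suc D   ≡⟨ ℕ.*-distribʳ-+ (suc D) s N ⟨
  (s + N) * suc D         ∎
  where
  open ℕ.≤-Reasoning
  open +-*-Solver

theorem1p6 : 1ℚ <ᴸ liminf (λ n → ratio (p n 3) (s n 3))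
theorem1p6 = liminf>1 s≤D*nonSparse
  where
  liminf>1 : ∃[ D ] (∀ {n} → 5 ≤ n → s n 3 ≤ length (nonSparsePavings n) * D) →
    1ℚ <ᴸ liminf (λ n → ratio (p n 3) (s n 3))
  -- From `n = 5` on a line of four points leaves a point outside. The rational `(2 + D) / (1 + D)`
  -- lies strictly between 1 and all these ratios.
  liminf>1 (D , s≤) = 5 , + (2 + D) ℚ./ suc D ,
    /-< {1} {0} {2 + D} {D} (ℕ.≤-reflexive (cong (_+_ 2) (trans (ℕ.+-identityʳ D) (sym (ℕ.*-identityʳ D))))) ,
    λ (n , 5≤n) → let 0<s = s>0 (ℕ.≤-trans (s≤s (s≤s (s≤s z≤n))) 5≤n) in
      <-ratio {2 + D} {D} 0<s
        (subst (λ P → (2 + D) * s n 3 < P * suc D) (sym (p≡s+nonSparse n)) (ratio-gap D 0<s (s≤ 5≤n)))
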